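{- For every $k \geq 2$, $$\frac{k(k-1)}{4} \leq AR_s(P_{k-1}) \quad\text{and}\quad AR_s(M_k) = \binom{k+1}{2},$$ and for every $k\geq 3$, $$AR_s(P_{k-1}) \leq AR_s(C_k) \leq k^2.$$
   Context: All graphs are finite and simple. $P_k$ is the path with $k$ edges, $C_k$ the cycle with $k$ edges, $M_k$ the matching with $k$ edges. An edge-coloring is proper if adjacent edges receive distinct colors; an edge-colored graph is rainbow if all its edges have distinct colors. A copy of $H$ is a (not necessarily induced) subgraph isomorphic to $H$. $AR_s(H)$ is the smallest number of edges in a graph $G$ such that every proper edge-coloring of $G$ contains a rainbow copy of $H$. -}

module Defs where

open import Data.Nat using (ℕ; suc; _+_; _≤_; s≤s)
import Data.Nat.Properties as ℕₚ
open import Data.Empty using (⊥)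
open import Data.Fin using (Fin; toℕ; _<_)
open import Data.Fin.Properties using (_<?_)
open import Data.List using (List; length; filter; cartesianProduct; allFin)
open import Data.Product using (Σ-syntax; _×_; _,_)
open import Data.Sum using (_⊎_; inj₁; inj₂)
open import Function.Definitions using (Injective)
open import Level using (0ℓ)
open import Relation.Binary.Core using (Rel)
open import Relation.Binary.Definitions using (Symmetric; Irreflexive; Decidable)
open import Relation.Binary.Construct.Closure.Symmetric using (SymClosure; fwd; bwd; symmetric)
open import Relation.Binary.PropositionalEquality using (_≡_; _≢_; refl; sym)
open import Relation.Nullary using (¬_)
open import Relation.Nullary.Decidable using (_×-dec_; _⊎-dec_; map′)

record Graph : Set₁ where
  field
    order      : ℕ
    Adj        : Rel (Fin order) 0ℓ
    Adj?       : Decidable Adj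
    Adj-sym    : Symmetric Adj
    Adj-irrefl : Irreflexive _≡_ Adj

  Vertex : Set
  Vertex = Fin order

  -- Each edge is listed once, with its smaller end first.
  edges : List (Vertex × Vertex)
  edges = filter (λ (u , v) → (u <? v) ×-dec Adj? u v)
                 (cartesianProduct (allFin order) (allFin order))

  size : ℕ
  size = length edges

open Graph public using (Vertex; size)

-- The colour of an edge uv is colour u v.  The values on pairs that are not
-- edges are never used.
record ProperColouring (G : Graph) : Set where
  open Graph G using (Adj)
  field
    colour     : Vertex G → Vertex G → ℕ
    colour-sym : ∀ u v → colour u v ≡ colour v u
    proper     : ∀ {u v w} → Adj u v → Adj u w → v ≢ w →
                 colour u v ≢ colour u w

-- The copy itself is the image of H under embed, a subgraph of G that need
-- not be induced.
record Copy (H G : Graph) : Set where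
  field
    embed     : Vertex H → Vertex G
    injective : Injective _≡_ _≡_ embed
    preserves : ∀ {u v} → Graph.Adj H u v → Graph.Adj G (embed u) (embed v)

Rainbow : (H : Graph) → (Vertex H → Vertex H → ℕ) → Set
Rainbow H c = ∀ {u v x y} → Adj u v → Adj x y → c u v ≡ c x y →
              (u ≡ x × v ≡ y) ⊎ (u ≡ y × v ≡ x)
  where open Graph H using (Adj)

ContainsRainbow : (H : Graph) {G : Graph} → ProperColouring G → Set
ContainsRainbow H {G} c =
  Σ[ φ ∈ Copy H G ] Rainbow H (λ u v → colour (Copy.embed φ u) (Copy.embed φ v))
  where open ProperColouring c using (colour)

ForcesRainbow : Graph → Graph → Set
ForcesRainbow G H = (c : ProperColouring G) → ContainsRainbow H c

-- IsARₛ H m says that AR_s(H) exists and equals m.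
record IsARₛ (H : Graph) (m : ℕ) : Set₁ where
  field
    attained : Σ[ G ∈ Graph ] (size G ≡ m × ForcesRainbow G H)
    minimal  : ∀ G → ForcesRainbow G H → m ≤ size G

symClosure? : ∀ {n} {R : Rel (Fin n) 0ℓ} → Decidable R → Decidable (SymClosure R)
symClosure? R? u v = map′ (λ { (inj₁ r) → fwd r ; (inj₂ r) → bwd r })
                          (λ { (fwd r) → inj₁ r ; (bwd r) → inj₂ r })
                          (R? u v ⊎-dec R? v u)

underlying : (n : ℕ) (R : Rel (Fin n) 0ℓ) → Decidable R → (∀ u → ¬ R u u) → Graph
underlying n R R? irr = record
  { order      = n
  ; Adj        = SymClosure R
  ; Adj?       = symClosure? R?
  ; Adj-sym    = symmetric R
  ; Adj-irrefl = λ { refl (fwd r) → irr _ r ; refl (bwd r) → irr _ r }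
  }

-- k counts edges, so there are k + 1 vertices.
path : ℕ → Graph
path k = underlying (suc k)
  (λ u v → toℕ v ≡ suc (toℕ u))
  (λ u v → toℕ v ℕₚ.≟ suc (toℕ u))
  (λ u eq → ℕₚ.1+n≢n (sym eq))

cycle : (k : ℕ) → 3 ≤ k → Graph
cycle k 3≤k = underlying k
  (λ u v → toℕ v ≡ suc (toℕ u) ⊎ (suc (toℕ u) ≡ k × toℕ v ≡ 0))
  (λ u v → (toℕ v ℕₚ.≟ suc (toℕ u)) ⊎-dec
           ((suc (toℕ u) ℕₚ.≟ k) ×-dec (toℕ v ℕₚ.≟ 0)))
  (λ { u (inj₁ eq) → ℕₚ.1+n≢n (sym eq)
     ; u (inj₂ (last , first)) → noLoop 3≤k last first })
  where
  noLoop : ∀ {k i} → 3 ≤ k → suc i ≡ k → i ≡ 0 → ⊥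
  noLoop (s≤s ()) refl refl

-- The k edges join i to k + i, for i < k.
matching : ℕ → Graph
matching k = underlying (k + k)
  (λ u v → toℕ v ≡ k + toℕ u)
  (λ u v → toℕ v ℕₚ.≟ k + toℕ u)
  (noLoop k)
  where
  noLoop : ∀ k (u : Fin (k + k)) → toℕ u ≢ k + toℕ u
  noLoop (suc k) u eq = ℕₚ.m≢1+n+m (toℕ u) eq

{-# OPTIONS --safe #-}

-- Lower bounds.  Call a set of edges a j-union if it is the union of j
-- matchings.  If every proper colouring of G has a rainbow j-union with T edges,
-- then G contains a matching with at least T / j edges.  Deleting it and giving it
-- one new colour shows that the rest of G forces a rainbow j-union with T - 1
-- edges.  Summing up, T (T + 1) ≤ 2 j |E(G)|.  The matching M_k is a 1-union with
-- k edges and the path P_{k-1} is a 2-union with k - 1 edges.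
--
-- Upper bounds.  Disjoint stars with 1, 2, …, k edges force a rainbow M_k: choose
-- edges greedily, the largest star last.  For C_k, blow up every second vertex of
-- the cycle into a row of vertices and choose one vertex from each row greedily;
-- the number of candidates a row needs is 1 more than twice the number of colours
-- used before.
--
-- That the minimum exists for paths and cycles is shown by deciding, for every m,
-- whether some graph with at most m edges forces H: its isolated vertices can be
-- dropped, which leaves at most 2 m vertices, and only colourings of a graph on n
-- vertices with n² colours need to be tested.
module Submission where

open import Defs
open import Data.Nat
  using (ℕ; zero; suc; _+_; _*_; _∸_; _^_; _≤_; _<_; _%_; NonZero; z≤n; s≤s; s<s; s<s⁻¹; s≤s⁻¹)
import Data.Nat as ℕ
import Data.Nat.Properties as ℕₚ
open import Data.Nat.Combinatorics using (_C_; nC1≡n; nCk+nC[k+1]≡[n+1]C[k+1])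
open import Data.Nat.DivMod using (_mod_; m<n⇒m%n≡m; n%n≡0; m≤n⇒[n∸m]%m≡n%m; m%n<n)
open import Data.Nat.Induction using (Acc; acc; <-wellFounded)
open import Data.Nat.Tactic.RingSolver using (solve-∀)
open import Data.Integer as ℤ using (+_)
import Data.Integer.Properties as ℤₚ
open import Data.Rational.Unnormalised using (_/_; *≤*) renaming (_≤_ to _≤ℚ_)
open import Data.Fin as Fin
  using (Fin; toℕ; fromℕ<; inject≤; inject₁; combine; remQuot; finToFun; funToFin; _↑ˡ_; _↑ʳ_)
import Data.Fin.Properties as Finₚ
open import Data.List
  using (List; []; _∷_; length; filter; map; lookup; _++_; concat; tabulate; replicate;
         applyUpTo; upTo; allFin; cartesianProduct; cartesianProductWith; deduplicate)
open import Data.List.Properties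
  using (length-map; length-++; length-tabulate; length-applyUpTo; length-replicate;
         length-deduplicate; filter-all)
open import Data.List.Membership.Propositional using (_∈_; _∉_)
open import Data.List.Membership.DecPropositional ℕ._≟_ using (_∈?_)
open import Data.List.Membership.Propositional.Properties
  using (∈-lookup; ∈-filter⁺; ∈-map⁺; ∈-++⁺ˡ; ∈-++⁺ʳ; ∈-concat⁺′; ∈-tabulate⁺; ∈-applyUpTo⁺;
         ∈-upTo⁺; ∈-allFin; ∈-cartesianProduct⁺; ∈-cartesianProductWith⁺; ∈-deduplicate⁺)
open import Data.List.Relation.Unary.All as All using (All; []; _∷_)
import Data.List.Relation.Unary.All.Properties as Allₚ
open import Data.List.Relation.Unary.Any as Any using (Any; here; there)
import Data.List.Relation.Unary.Any.Properties as Anyₚ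
open import Data.List.Relation.Unary.AllPairs as AllPairs using (AllPairs; []; _∷_)
import Data.List.Relation.Unary.AllPairs.Properties as AllPairsₚ
open import Data.List.Relation.Unary.Unique.DecPropositional.Properties using (deduplicate-!)
import Data.List.Relation.Unary.Unique.Propositional.Properties as Uniqueₚ
open import Data.Product using (∃; ∃-syntax; _×_; _,_; proj₁; proj₂; uncurry)
open import Data.Sum using (_⊎_; inj₁; inj₂; [_,_]′)
open import Function using (_∘_; id)
open import Function.Definitions using (Injective)
open import Level using (0ℓ)
open import Relation.Binary.Construct.Closure.Symmetric using (SymClosure; fwd; bwd)
open import Relation.Binary.Core using (Rel)
open import Relation.Binary.Definitions using (DecidableEquality; tri<; tri≈; tri>)
open import Relation.Binary.PropositionalEquality
  using (_≡_; _≢_; _≗_; refl; sym; trans; cong; cong₂; subst; subst₂; ≢-sym)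
open import Relation.Nullary using (¬_; Dec; yes; no; contradiction)
open import Relation.Nullary.Decidable
  using (_×-dec_; _⊎-dec_; _→-dec_; ¬?; map′; decidable-stable)
open import Relation.Unary using (Pred; Decidable)

open Graph using (Adj; Adj?; Adj-sym; Adj-irrefl)
open ProperColouring using (colour; colour-sym; proper)

private variable
  A B : Set

-- Lists with pairwise related entries

AllPairs-lookup : {R : Rel A 0ℓ} {xs : List A} → AllPairs R xs →
                  ∀ {i j} → i Fin.< j → R (lookup xs i) (lookup xs j)
AllPairs-lookup (rs ∷ _)  {Fin.zero}  {Fin.suc j} _   = All.lookup rs (∈-lookup j)
AllPairs-lookup (_ ∷ rss) {Fin.suc i} {Fin.suc j} i<j = AllPairs-lookup rss (s<s⁻¹ i<j)

AllPairs-strengthen : {R : Rel A 0ℓ} {P : Pred A 0ℓ} {xs : List A} → All P xs → AllPairs R xs →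
                      AllPairs (λ x y → P x × P y × R x y) xs
AllPairs-strengthen []       []         = []
AllPairs-strengthen (p ∷ ps) (rs ∷ rss) =
  All.zipWith (λ (q , r) → p , q , r) (ps , rs) ∷ AllPairs-strengthen ps rss

-- Sending each position in `xs` to the position of a related entry of `ys` is injective, because no
-- `y` is related to two entries of `xs`. A relation replaces equality since edges are compared up
-- to orientation.
length-≤-by : (R : A → B → Set) {xs : List A} {ys : List B} →
              AllPairs (λ x x′ → ∀ y → R x y → ¬ R x′ y) xs →
              All (λ x → Any (R x) ys) xs → length xs ≤ length ys
length-≤-by R {xs} {ys} apart hits = Finₚ.injective⇒≤ {f = f} f-injective
  where
  hit : ∀ i → Any (R (lookup xs i)) ys
  hit i = All.lookup hits (∈-lookup i)
  f : Fin (length xs) → Fin (length ys)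
  f i = Any.index (hit i)
  clash : ∀ {i j} → f i ≡ f j → ¬ i Fin.< j
  clash {i} {j} eq i<j = AllPairs-lookup apart i<j _ (Anyₚ.lookup-index (hit i))
    (subst (λ z → R (lookup xs j) (lookup ys z)) (sym eq) (Anyₚ.lookup-index (hit j)))
  f-injective : ∀ {i j} → f i ≡ f j → i ≡ j
  f-injective {i} {j} eq with Finₚ.<-cmp i j
  ... | tri< i<j _ _ = contradiction i<j (clash eq)
  ... | tri≈ _ i≡j _ = i≡j
  ... | tri> _ _ j<i = contradiction j<i (clash (sym eq))

-- Edges as unordered pairs, and counting them

SameEdge : Rel (A × A) 0ℓ
SameEdge (u , v) (x , y) = (u ≡ x × v ≡ y) ⊎ (u ≡ y × v ≡ x)

SameEdge-sym : {e f : A × A} → SameEdge e f → SameEdge f e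
SameEdge-sym (inj₁ (refl , refl)) = inj₁ (refl , refl)
SameEdge-sym (inj₂ (refl , refl)) = inj₂ (refl , refl)

SameEdge-trans : {e f g : A × A} → SameEdge e f → SameEdge f g → SameEdge e g
SameEdge-trans (inj₁ (refl , refl)) s                    = s
SameEdge-trans (inj₂ (refl , refl)) (inj₁ (refl , refl)) = inj₂ (refl , refl)
SameEdge-trans (inj₂ (refl , refl)) (inj₂ (refl , refl)) = inj₁ (refl , refl)

SameEdge-swapˡ : {u v : A} {e : A × A} → SameEdge (u , v) e → SameEdge (v , u) e
SameEdge-swapˡ = SameEdge-trans (inj₂ (refl , refl))

sameEdge? : DecidableEquality A → (e f : A × A) → Dec (SameEdge e f)
sameEdge? _≟_ (u , v) (x , y) = ((u ≟ x) ×-dec (v ≟ y)) ⊎-dec ((u ≟ y) ×-dec (v ≟ x))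

DistinctEdges : List (A × A) → Set
DistinctEdges = AllPairs (λ e f → ¬ SameEdge e f)

count-edges : {xs ys : List (A × A)} → DistinctEdges xs →
              All (λ e → Any (SameEdge e) ys) xs → length xs ≤ length ys
count-edges distinct = length-≤-by SameEdge
  (AllPairs.map (λ e≉f _ e~g f~g → e≉f (SameEdge-trans e~g (SameEdge-sym f~g))) distinct)

module _ (G : Graph) where

  private
    E : Rel (Vertex G) 0ℓ
    E = Adj G

    listed? : (e : Vertex G × Vertex G) → Dec ((proj₁ e Fin.< proj₂ e) × E (proj₁ e) (proj₂ e))
    listed? (u , v) = (u Finₚ.<? v) ×-dec Adj? G u v

  edges-listed : All (λ (u , v) → (u Fin.< v) × E u v) (Graph.edges G)
  edges-listed = Allₚ.all-filter listed? (cartesianProduct (allFin _) (allFin _))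

  edges-adjacent : All (λ (u , v) → E u v) (Graph.edges G)
  edges-adjacent = All.map proj₂ edges-listed

  -- No pair is listed twice, and none is the reverse of another because all listed pairs are
  -- increasing.
  edges-distinct : DistinctEdges (Graph.edges G)
  edges-distinct = AllPairs.map apart (AllPairs-strengthen edges-listed
    (Uniqueₚ.filter⁺ listed? (Uniqueₚ.cartesianProduct⁺ (Uniqueₚ.allFin⁺ _) (Uniqueₚ.allFin⁺ _))))
    where
    apart : ∀ {e f} → ((proj₁ e Fin.< proj₂ e) × E (proj₁ e) (proj₂ e)) ×
            ((proj₁ f Fin.< proj₂ f) × E (proj₁ f) (proj₂ f)) × e ≢ f → ¬ SameEdge e f
    apart (_ , _ , e≢f) (inj₁ (refl , refl)) = e≢f refl
    apart ((u<v , _) , (v<u , _) , _) (inj₂ (refl , refl)) = Finₚ.<-asym u<v v<u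

  edges-complete : ∀ {u v} → E u v → Any (SameEdge (u , v)) (Graph.edges G)
  edges-complete {u} {v} uv with Finₚ.<-cmp u v
  ... | tri< u<v _ _ = Any.map (λ { refl → inj₁ (refl , refl) })
          (∈-filter⁺ listed? (∈-cartesianProduct⁺ (∈-allFin u) (∈-allFin v)) (u<v , uv))
  ... | tri≈ _ u≡v _ = contradiction uv (Adj-irrefl G u≡v)
  ... | tri> _ _ v<u = Any.map (λ { refl → inj₂ (refl , refl) })
          (∈-filter⁺ listed? (∈-cartesianProduct⁺ (∈-allFin v) (∈-allFin u)) (v<u , Adj-sym G uv))

  length≤size : {xs : List (Vertex G × Vertex G)} → DistinctEdges xs →
                All (λ (u , v) → E u v) xs → length xs ≤ size G
  length≤size distinct adjacent = count-edges distinct (All.map edges-complete adjacent)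

  size≤length : {ys : List (Vertex G × Vertex G)} →
                (∀ {u v} → E u v → Any (SameEdge (u , v)) ys) → size G ≤ length ys
  size≤length covers = count-edges edges-distinct (All.map covers edges-adjacent)

-- Lower bounds: deleting a matching

-- Proper because addition is cancellative. The forcing hypothesis is applied to it in
-- `union-lower-bound` to obtain a matching.
sumColouring : ∀ G → ProperColouring G
sumColouring G .colour u v         = toℕ u + toℕ v
sumColouring G .colour-sym u v     = ℕₚ.+-comm (toℕ u) (toℕ v)
sumColouring G .proper _ _ v≢w eq  = v≢w (Finₚ.toℕ-injective (ℕₚ.+-cancelˡ-≡ _ _ _ eq))

Disjoint : Rel (A × A) 0ℓ
Disjoint (u , v) (x , y) = u ≢ x × u ≢ y × v ≢ x × v ≢ y

Disjoint⇒¬SameEdge : {e f : A × A} → Disjoint e f → ¬ SameEdge e f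
Disjoint⇒¬SameEdge (u≢x , _)     (inj₁ (u≡x , _)) = u≢x u≡x
Disjoint⇒¬SameEdge (_ , u≢y , _) (inj₂ (u≡y , _)) = u≢y u≡y

-- A matching of G gets one new colour; the rest of G keeps its colouring.
module RemoveMatching (G : Graph) (M : List (Vertex G × Vertex G))
                      (M-disjoint : AllPairs Disjoint M) where

  InM : Rel (Vertex G) 0ℓ
  InM u v = Any (SameEdge (u , v)) M

  InM? : ∀ u v → Dec (InM u v)
  InM? u v = Any.any? (sameEdge? Fin._≟_ (u , v)) M

  InM-sym : ∀ {u v} → InM u v → InM v u
  InM-sym = Any.map SameEdge-swapˡ

  -- Edges of `M` that meet in `u` are the same entry of the list. Hence a single colour on all of
  -- `M` is proper.
  InM-unique : ∀ {u v w} → InM u v → InM u w → v ≡ w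
  InM-unique = unique M-disjoint
    where
    meet : ∀ {N e} {u v w : Vertex G} → All (Disjoint e) N → SameEdge (u , v) e →
           ¬ Any (SameEdge (u , w)) N
    meet (d ∷ _)  (inj₁ (refl , refl)) (here (inj₁ (refl , refl))) = proj₁ d refl
    meet (d ∷ _)  (inj₁ (refl , refl)) (here (inj₂ (refl , refl))) = proj₁ (proj₂ d) refl
    meet (d ∷ _)  (inj₂ (refl , refl)) (here (inj₁ (refl , refl))) = proj₁ (proj₂ (proj₂ d)) refl
    meet (d ∷ _)  (inj₂ (refl , refl)) (here (inj₂ (refl , refl))) = proj₂ (proj₂ (proj₂ d)) refl
    meet (_ ∷ ds) s                    (there m)                   = meet ds s m
    unique : ∀ {N} {u v w : Vertex G} → AllPairs Disjoint N →
             Any (SameEdge (u , v)) N → Any (SameEdge (u , w)) N → v ≡ w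
    unique _ (here (inj₁ (refl , refl))) (here (inj₁ (refl , refl))) = refl
    unique _ (here (inj₁ (refl , refl))) (here (inj₂ (refl , refl))) = refl
    unique _ (here (inj₂ (refl , refl))) (here (inj₁ (refl , refl))) = refl
    unique _ (here (inj₂ (refl , refl))) (here (inj₂ (refl , refl))) = refl
    unique (d ∷ _) (here s)  (there m) = contradiction m (meet d s)
    unique (d ∷ _) (there m) (here s)  = contradiction m (meet d s)
    unique (_ ∷ ds) (there m) (there m′) = unique ds m m′

  rest : Graph
  rest = record
    { order      = Graph.order G
    ; Adj        = λ u v → Adj G u v × ¬ InM u v
    ; Adj?       = λ u v → Adj? G u v ×-dec ¬? (InM? u v)
    ; Adj-sym    = λ (uv , ∉M) → Adj-sym G uv , ∉M ∘ InM-sym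
    ; Adj-irrefl = λ eq → Adj-irrefl G eq ∘ proj₁
    }

  -- `M` followed by the edges of `rest` is a list of pairwise distinct edges of `G`.
  size-rest : All (λ (u , v) → Adj G u v) M → length M + size rest ≤ size G
  size-rest M-adj = subst (_≤ size G) (length-++ M) (length≤size G
    (AllPairsₚ.++⁺ (AllPairs.map Disjoint⇒¬SameEdge M-disjoint) (edges-distinct rest)
      (All.map (λ e∈M → All.map (λ (_ , f∉M) e~f → f∉M (Any.map
        (λ { refl → SameEdge-sym e~f }) e∈M)) (edges-adjacent rest)) (All.tabulate λ e∈M → e∈M)))
    (Allₚ.++⁺ M-adj (All.map proj₁ (edges-adjacent rest))))

  module _ (c : ProperColouring rest) where

    private
      -- Colour 0 is reserved for `M`; `suc` keeps the old colours away from it.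
      newOr : {P : Set} → Dec P → ℕ → ℕ
      newOr (yes _) n = 0
      newOr (no  _) n = suc n

    extend : ProperColouring G
    extend .colour u v = newOr (InM? u v) (colour c u v)
    extend .colour-sym u v with InM? u v | InM? v u
    ... | yes _  | yes _   = refl
    ... | yes m  | no  ¬m  = contradiction (InM-sym m) ¬m
    ... | no  ¬m | yes m   = contradiction (InM-sym m) ¬m
    ... | no  _  | no  _   = cong suc (colour-sym c u v)
    extend .proper {u} {v} {w} uv uw v≢w eq with InM? u v | InM? u w
    -- In the two mixed cases `eq` would equate 0 with a successor.
    ... | yes m  | yes m′  = v≢w (InM-unique m m′)
    ... | no  ¬m | no  ¬m′ = proper c (uv , ¬m) (uw , ¬m′) v≢w (ℕₚ.suc-injective eq)

    extend-in : ∀ {u v} → InM u v → colour extend u v ≡ 0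
    extend-in {u} {v} m with InM? u v
    ... | yes _ = refl
    ... | no ¬m = contradiction m ¬m

    extend-out : ∀ {u v} → ¬ InM u v → colour extend u v ≡ suc (colour c u v)
    extend-out {u} {v} ¬m with InM? u v
    ... | yes m = contradiction m ¬m
    ... | no  _ = refl

-- A union of j matchings: the edges with the same tag are pairwise disjoint.
module _ (G : Graph) where

  TaggedEdge : Set
  TaggedEdge = (Vertex G × Vertex G) × ℕ

  record RainbowUnion (j T : ℕ) (c : ProperColouring G) : Set where
    field
      edges    : List TaggedEdge
      enough   : T ≤ length edges
      tags     : All (λ e → proj₂ e < j) edges
      adjacent : All (λ ((u , v) , _) → Adj G u v) edges
      disjoint : AllPairs (λ (e , s) (f , t) → s ≡ t → Disjoint e f) edges
      rainbow  : AllPairs (λ ((u , v) , _) ((x , y) , _) → colour c u v ≢ colour c x y) edges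

  ForcesUnion : ℕ → ℕ → Set
  ForcesUnion j T = (c : ProperColouring G) → RainbowUnion j T c

-- Popular tags and the induction for the lower bound

tagged? : (t : ℕ) → Decidable {A = A × ℕ} (λ e → proj₂ e ≡ t)
tagged? t e = proj₂ e ℕ.≟ t

withTag : ℕ → List (A × ℕ) → List (A × ℕ)
withTag t = filter (tagged? t)

without : {P : Pred A 0ℓ} → Decidable P → List A → List A
without P? = filter (¬? ∘ P?)

length-split : {P : Pred A 0ℓ} (P? : Decidable P) (xs : List A) →
               length xs ≡ length (filter P? xs) + length (without P? xs)
length-split P? []       = refl
length-split P? (x ∷ xs) with P? x
... | yes _ = cong suc (length-split P? xs)
... | no  _ = trans (cong suc (length-split P? xs)) (sym (ℕₚ.+-suc _ _))

length-filter-without : {P Q : Pred A 0ℓ} (P? : Decidable P) (Q? : Decidable Q) (xs : List A) →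
                        length (filter P? (without Q? xs)) ≤ length (filter P? xs)
length-filter-without P? Q? []       = z≤n
length-filter-without P? Q? (x ∷ xs) with Q? x | P? x in eq
... | yes _ | yes _ = ℕₚ.m≤n⇒m≤1+n (length-filter-without P? Q? xs)
... | yes _ | no  _ = length-filter-without P? Q? xs
... | no  _ | yes _ rewrite eq = s≤s (length-filter-without P? Q? xs)
... | no  _ | no  _ rewrite eq = length-filter-without P? Q? xs

-- Pigeonhole by induction on `j`: the class of tag `j` competes with the class that the induction
-- hypothesis finds among the other tags, and the larger one wins.
popular-tag : ∀ j (es : List (A × ℕ)) → All (λ e → proj₂ e < j) es →
              ∃[ t ] length es ≤ j * length (withTag t es)
-- The list is empty, and the tag 0 is a default.
popular-tag zero    []       _        = 0 , z≤n
popular-tag zero    (_ ∷ _)  (() ∷ _)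
popular-tag (suc j) es       tags<1+j = choose (ℕₚ.≤-total x y)
  where
  others : List _
  others = without (tagged? j) es
  others<j : All (λ e → proj₂ e < j) others
  others<j = All.zipWith (λ (s≢j , s<1+j) → ℕₚ.≤∧≢⇒< (s≤s⁻¹ s<1+j) s≢j)
    (Allₚ.all-filter _ es , Allₚ.filter⁺ _ tags<1+j)
  ih : ∃[ t ] length others ≤ j * length (withTag t others)
  ih = popular-tag j others others<j
  x y : ℕ
  x = length (withTag j es)
  y = length (withTag (proj₁ ih) es)
  total : length es ≤ x + j * y
  total = ℕₚ.≤-trans (ℕₚ.≤-reflexive (length-split (tagged? j) es))
    (ℕₚ.+-monoʳ-≤ x (ℕₚ.≤-trans (proj₂ ih)
      (ℕₚ.*-monoʳ-≤ j (length-filter-without (tagged? (proj₁ ih)) (tagged? j) es))))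
  choose : x ≤ y ⊎ y ≤ x → ∃[ t ] length es ≤ suc j * length (withTag t es)
  choose (inj₁ x≤y) = proj₁ ih , ℕₚ.≤-trans total (ℕₚ.+-monoˡ-≤ _ x≤y)
  choose (inj₂ y≤x) = j , ℕₚ.≤-trans total (ℕₚ.+-monoʳ-≤ x (ℕₚ.*-monoʳ-≤ j y≤x))

-- Two entries satisfying `P` would be related by `R`, which is excluded, so at most one entry is
-- dropped.
length-without-≤1 : {R : Rel A 0ℓ} {P : Pred A 0ℓ} (P? : Decidable P) →
                    (∀ {x y} → P x → P y → ¬ R x y) → {xs : List A} → AllPairs R xs →
                    length xs ≤ suc (length (without P? xs))
length-without-≤1 P? clash []                = z≤n
length-without-≤1 P? clash {x ∷ xs} (rs ∷ rss) with P? x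
... | yes px = s≤s (ℕₚ.≤-reflexive (cong length (sym
                 (filter-all (¬? ∘ P?) (All.map (λ r py → clash px py r) rs)))))
... | no  _  = s≤s (length-without-≤1 P? clash rss)

-- Colour `M` with one new colour. A rainbow union in `G` uses that colour at most once, so all but
-- at most one of its edges lie in the rest and are rainbow there.
forces-rest : ∀ {j T} G {M} (M-disjoint : AllPairs Disjoint M) → ForcesUnion G j (suc T) →
              ForcesUnion (RemoveMatching.rest G M M-disjoint) j T
forces-rest {j} {T} G {M} M-disjoint forces c = record
  { edges    = es′
  ; enough   = s≤s⁻¹ (ℕₚ.≤-trans (enough U) (length-without-≤1 inM? (λ {e} {f} → clash {e} {f}) (rainbow U)))
  ; tags     = Allₚ.filter⁺ _ (tags U)
  ; adjacent = All.zipWith (λ p → p) (Allₚ.filter⁺ _ (adjacent U) , outside)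
  ; disjoint = AllPairsₚ.filter⁺ _ (disjoint U)
  ; rainbow  = AllPairs.map (λ (e∉M , f∉M , e≢f) eq → e≢f (trans (extend-out c e∉M)
                 (trans (cong suc eq) (sym (extend-out c f∉M)))))
                 (AllPairs-strengthen outside (AllPairsₚ.filter⁺ _ (rainbow U)))
  }
  where
  open RainbowUnion
  open RemoveMatching G M M-disjoint
  U : RainbowUnion G j (suc T) (extend c)
  U = forces (extend c)
  inM? : (e : TaggedEdge G) → Dec (InM (proj₁ (proj₁ e)) (proj₂ (proj₁ e)))
  inM? ((u , v) , _) = InM? u v
  es′ : List (TaggedEdge G)
  es′ = without inM? (edges U)
  outside : All (λ ((u , v) , _) → ¬ InM u v) es′
  outside = Allₚ.all-filter _ (edges U)
  clash : ∀ {e f : TaggedEdge G} → InM (proj₁ (proj₁ e)) (proj₂ (proj₁ e)) →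
          InM (proj₁ (proj₁ f)) (proj₂ (proj₁ f)) →
          ¬ colour (extend c) (proj₁ (proj₁ e)) (proj₂ (proj₁ e)) ≢
            colour (extend c) (proj₁ (proj₁ f)) (proj₂ (proj₁ f))
  clash e∈M f∈M e≢f = e≢f (trans (extend-in c e∈M) (sym (extend-in c f∈M)))

-- Induction on `T`: a popular tag class of one rainbow union is a matching with at least
-- `suc T / j` edges, and without it the graph still forces `T`. The factor `2 * j` clears all
-- fractions.
union-lower-bound : ∀ j T G → ForcesUnion G j T → T * suc T ≤ 2 * j * size G
union-lower-bound j zero    G _      = z≤n
union-lower-bound j (suc T) G forces = begin
  suc T * suc (suc T)                      ≡⟨ arith₁ T ⟩
  2 * suc T + T * suc T                    ≤⟨ ℕₚ.+-mono-≤ (ℕₚ.*-monoʳ-≤ 2 big)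
                                                (union-lower-bound j T rest
                                                  (forces-rest G M-disjoint forces)) ⟩
  2 * (j * length M) + 2 * j * size rest   ≡⟨ arith₂ j (length M) (size rest) ⟩
  2 * j * (length M + size rest)           ≤⟨ ℕₚ.*-monoʳ-≤ (2 * j) (size-rest M-adjacent) ⟩
  2 * j * size G                           ∎
  where
  open RainbowUnion
  open ℕₚ.≤-Reasoning
  U : RainbowUnion G j (suc T) (sumColouring G)
  U = forces (sumColouring G)
  popular : ∃[ t ] length (edges U) ≤ j * length (withTag t (edges U))
  popular = popular-tag j (edges U) (tags U)
  t : ℕ
  t = proj₁ popular
  M : List (Vertex G × Vertex G)
  M = map proj₁ (withTag t (edges U))
  M-disjoint : AllPairs Disjoint M
  M-disjoint = AllPairsₚ.map⁺ (AllPairs.map (λ (s≡t , s′≡t , d) → d (trans s≡t (sym s′≡t)))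
    (AllPairs-strengthen (Allₚ.all-filter (tagged? t) (edges U))
      (AllPairsₚ.filter⁺ (tagged? t) (disjoint U))))
  M-adjacent : All (λ (u , v) → Adj G u v) M
  M-adjacent = Allₚ.map⁺ (Allₚ.filter⁺ (tagged? t) (adjacent U))
  big : suc T ≤ j * length M
  big = ℕₚ.≤-trans (enough U) (ℕₚ.≤-trans (proj₂ popular)
    (ℕₚ.≤-reflexive (cong (j *_) (sym (length-map proj₁ (withTag t (edges U)))))))
  open RemoveMatching G M M-disjoint
  arith₁ : ∀ n → suc n * suc (suc n) ≡ 2 * suc n + n * suc n
  arith₁ = solve-∀
  arith₂ : ∀ a b d → 2 * (a * b) + 2 * a * d ≡ 2 * a * (b + d)
  arith₂ = solve-∀

-- Rainbow paths and matchings as unions of matchings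

parity-flips : ∀ n → suc n % 2 ≢ n % 2
parity-flips zero          ()
parity-flips (suc zero)    ()
parity-flips (suc (suc n)) = parity-flips n

n%2<2 : ∀ n → n % 2 < 2
n%2<2 zero          = s≤s z≤n
n%2<2 (suc zero)    = s≤s (s≤s z≤n)
n%2<2 (suc (suc n)) = n%2<2 n

-- A path splits into the matchings formed by its even and its odd edges.
path-union : ∀ G t → ForcesRainbow G (path t) → ForcesUnion G 2 t
path-union G t forces c with forces c
... | φ , rb = record
  { edges    = tabulate edge
  ; enough   = ℕₚ.≤-reflexive (sym (length-tabulate edge))
  ; tags     = Allₚ.tabulate⁺ (n%2<2 ∘ toℕ)
  ; adjacent = Allₚ.tabulate⁺ (preserves ∘ step)
  ; disjoint = AllPairsₚ.tabulate⁺ (λ {i} {j} i≢j same →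
      (i≢j ∘ Finₚ.inject₁-injective ∘ injective)
    , shifted same ∘ injective
    , shifted (sym same) ∘ sym ∘ injective
    , (i≢j ∘ Finₚ.suc-injective ∘ injective))
  ; rainbow  = AllPairsₚ.tabulate⁺ (λ {i} {j} i≢j eq → distinct i≢j (rb (step i) (step j) eq))
  }
  where
  open Copy φ
  edge : Fin t → TaggedEdge G
  edge i = (embed (inject₁ i) , embed (Fin.suc i)) , toℕ i % 2
  step : (i : Fin t) → Adj (path t) (inject₁ i) (Fin.suc i)
  step i = fwd (cong suc (sym (Finₚ.toℕ-inject₁ i)))
  -- Edge `i` starts where edge `j` ends only if `i` is the successor of `j`, and then their
  -- parities differ.
  shifted : ∀ {i j : Fin t} → toℕ i % 2 ≡ toℕ j % 2 → inject₁ i ≢ Fin.suc j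
  shifted {i} {j} same eq = parity-flips (toℕ j) (trans (cong (_% 2)
    (trans (cong toℕ (sym eq)) (Finₚ.toℕ-inject₁ i))) same)
  distinct : ∀ {i j : Fin t} → i ≢ j →
             ¬ SameEdge (inject₁ i , Fin.suc i) (inject₁ j , Fin.suc j)
  distinct i≢j (inj₁ (eq , _)) = i≢j (Finₚ.inject₁-injective eq)
  distinct {i} {j} _ (inj₂ (i≡1+j , 1+i≡j)) = ℕₚ.<-asym
    (ℕₚ.≤-reflexive (trans (sym (cong toℕ i≡1+j)) (Finₚ.toℕ-inject₁ i)))
    (ℕₚ.≤-reflexive (trans (cong toℕ 1+i≡j) (Finₚ.toℕ-inject₁ j)))

-- A matching is a single class, so every edge gets the tag 0.
matching-union : ∀ G k → ForcesRainbow G (matching k) → ForcesUnion G 1 k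
matching-union G k forces c with forces c
... | φ , rb = record
  { edges    = tabulate edge
  ; enough   = ℕₚ.≤-reflexive (sym (length-tabulate edge))
  ; tags     = Allₚ.tabulate⁺ {f = edge} (λ _ → s≤s z≤n)
  ; adjacent = Allₚ.tabulate⁺ {f = edge} (preserves ∘ rung)
  ; disjoint = AllPairsₚ.tabulate⁺ {f = edge} (λ {i} {j} i≢j _ →
      (i≢j ∘ Finₚ.↑ˡ-injective k i j ∘ injective)
    , crossed i j ∘ injective
    , crossed j i ∘ sym ∘ injective
    , (i≢j ∘ Finₚ.↑ʳ-injective k i j ∘ injective))
  ; rainbow  = AllPairsₚ.tabulate⁺ {f = edge} (λ {i} {j} i≢j eq →
      [ i≢j ∘ Finₚ.↑ˡ-injective k i j ∘ proj₁ , crossed i j ∘ proj₁ ]′ (rb (rung i) (rung j) eq))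
  }
  where
  open Copy φ
  edge : Fin k → TaggedEdge G
  edge i = (embed (i ↑ˡ k) , embed (k ↑ʳ i)) , 0
  rung : (i : Fin k) → Adj (matching k) (i ↑ˡ k) (k ↑ʳ i)
  rung i = fwd (trans (Finₚ.toℕ-↑ʳ k i) (cong (λ n → k + n) (sym (Finₚ.toℕ-↑ˡ i k))))
  crossed : ∀ (i j : Fin k) → i ↑ˡ k ≢ k ↑ʳ j
  crossed i j eq = ℕₚ.<⇒≱ (Finₚ.toℕ<n i) (ℕₚ.≤-trans (ℕₚ.m≤m+n k (toℕ j)) (ℕₚ.≤-reflexive
    (trans (sym (Finₚ.toℕ-↑ʳ k j)) (trans (sym (cong toℕ eq)) (Finₚ.toℕ-↑ˡ i k)))))

-- Finite search, and deciding whether a graph forces a rainbow copy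

-- Functions are searched through their codes in `Fin`. A decoded code agrees with the function only
-- pointwise, so `P` has to respect `≗`.
any-fun? : ∀ {m n} {P : (Fin m → Fin n) → Set} → (∀ {f g} → f ≗ g → P f → P g) →
           (∀ f → Dec (P f)) → Dec (∃ P)
any-fun? resp P? = map′
  (λ (x , p) → finToFun x , p)
  (λ (f , p) → funToFin f , resp (sym ∘ Finₚ.finToFun-funToFin f) p)
  (Finₚ.any? (P? ∘ finToFun))

any-fun₂? : ∀ {l m n} {P : (Fin l → Fin m → Fin n) → Set} →
            (∀ {f g} → (∀ i → f i ≗ g i) → P f → P g) →
            (∀ f → Dec (P f)) → Dec (∃ P)
any-fun₂? resp P? = map′
  (λ (x , p) → finToFun ∘ x , p)
  (λ (f , p) → funToFin ∘ f , resp (λ i → sym ∘ Finₚ.finToFun-funToFin (f i)) p)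
  (any-fun? (λ x≗y → resp (λ i j → cong (λ z → finToFun z j) (x≗y i))) (λ x → P? (finToFun ∘ x)))

least : {P : ℕ → Set} → (∀ n → Dec (P n)) → ∀ n → P n →
        ∃[ m ] (P m × (∀ i → P i → m ≤ i))
least {P} P? n = go n (<-wellFounded n)
  where
  go : ∀ n → Acc ℕ._<_ n → P n → ∃[ m ] (P m × (∀ i → P i → m ≤ i))
  go n (acc rs) p with ℕₚ.anyUpTo? P? n
  ... | yes (i , i<n , q) = go i (rs i<n) q
  ... | no  none          = n , p , λ i q → ℕₚ.≮⇒≥ (λ i<n → none (i , i<n , q))

-- Taking the first position gives equal colours equal new names even if the palette has
-- repetitions.
locate : List ℕ → ℕ → ℕ
locate []       x = 0
locate (y ∷ ys) x with x ℕ.≟ y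
... | yes _ = 0
... | no  _ = suc (locate ys x)

locate< : ∀ {x xs} → x ∈ xs → locate xs x < length xs
locate< {x} {y ∷ ys} x∈ with x ℕ.≟ y | x∈
... | yes _  | _         = s≤s z≤n
... | no x≢y | here x≡y  = contradiction x≡y x≢y
... | no _   | there x∈′ = s≤s (locate< x∈′)

locate-injective : ∀ {x y zs} → x ∈ zs → y ∈ zs → locate zs x ≡ locate zs y → x ≡ y
locate-injective {x} {y} {z ∷ zs} x∈ y∈ eq with x ℕ.≟ z | y ℕ.≟ z | x∈ | y∈
... | yes refl | yes refl | _         | _         = refl
... | no x≢z   | no _     | here x≡z  | _         = contradiction x≡z x≢z
... | no _     | no y≢z   | there _   | here y≡z  = contradiction y≡z y≢z
... | no _     | no _     | there x∈′ | there y∈′ =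
  locate-injective x∈′ y∈′ (ℕₚ.suc-injective eq)

module _ {n : ℕ} where

  Colours : Set
  Colours = Fin n → Fin n → ℕ

  -- Being proper and containing a rainbow copy only depend on which pairs
  -- share a colour, so n² colours suffice.
  record _⇛_ (c d : Colours) : Set where
    constructor refines
    field
      apply : ∀ {u v x y} → c u v ≡ c x y → d u v ≡ d x y

  numbered : ∀ {m} → (Fin n → Fin n → Fin m) → Colours
  numbered f u v = toℕ (f u v)

  -- The palette lists the colours of all `n * n` pairs; each colour is renamed to its first
  -- position there.
  normalise : (c : Colours) →
              ∃[ f ] (c ⇛ numbered {n * n} f × numbered f ⇛ c)
  normalise c = f
    , refines (λ eq → trans (toℕ-f _ _) (trans (cong (locate palette) eq) (sym (toℕ-f _ _))))
    , refines (λ eq → locate-injective (listed _ _) (listed _ _)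
        (trans (sym (toℕ-f _ _)) (trans eq (toℕ-f _ _))))
    where
    palette : List ℕ
    palette = tabulate (uncurry c ∘ remQuot {n} n)
    listed : ∀ u v → c u v ∈ palette
    listed u v = subst (λ p → uncurry c p ∈ palette) (Finₚ.remQuot-combine u v)
      (∈-tabulate⁺ (combine u v))
    bound : ∀ u v → locate palette (c u v) < n * n
    bound u v = subst (locate palette (c u v) <_) (length-tabulate _) (locate< (listed u v))
    f : Fin n → Fin n → Fin (n * n)
    f u v = fromℕ< (bound u v)
    toℕ-f : ∀ u v → toℕ (f u v) ≡ locate palette (c u v)
    toℕ-f u v = Finₚ.toℕ-fromℕ< (bound u v)

open _⇛_

module _ (G : Graph) where

  IsProper : Colours → Set
  IsProper c = (∀ u v → c u v ≡ c v u) ×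
               (∀ u v w → Adj G u v → Adj G u w → v ≢ w → c u v ≢ c u w)

  isProper? : ∀ c → Dec (IsProper c)
  isProper? c =
    Finₚ.all? (λ u → Finₚ.all? λ v → c u v ℕ.≟ c v u) ×-dec
    Finₚ.all? (λ u → Finₚ.all? λ v → Finₚ.all? λ w →
      Adj? G u v →-dec Adj? G u w →-dec ¬? (v Fin.≟ w) →-dec ¬? (c u v ℕ.≟ c u w))

  isProper-resp : ∀ {c d} → c ⇛ d → d ⇛ c → IsProper c → IsProper d
  isProper-resp to from (symm , prop) =
    (λ u v → apply to (symm u v)) , λ u v w uv uw v≢w eq → prop u v w uv uw v≢w (apply from eq)

  toProper : ∀ c → IsProper c → ProperColouring G
  toProper c (symm , prop) = record { colour = c ; colour-sym = symm ; proper = λ {u} {v} {w} → prop u v w }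

  module _ (H : Graph) where

    -- The content of `ContainsRainbow`, with explicit quantifiers over finite types so that each
    -- condition is decided by `Finₚ.all?`.
    IsRainbowCopy : Colours → (Vertex H → Vertex G) → Set
    IsRainbowCopy c e =
      (∀ u v → e u ≡ e v → u ≡ v) ×
      (∀ u v → Adj H u v → Adj G (e u) (e v)) ×
      (∀ u v x y → Adj H u v → Adj H x y → c (e u) (e v) ≡ c (e x) (e y) →
       SameEdge (u , v) (x , y))

    isRainbowCopy? : ∀ c e → Dec (IsRainbowCopy c e)
    isRainbowCopy? c e =
      Finₚ.all? (λ u → Finₚ.all? λ v → (e u Fin.≟ e v) →-dec (u Fin.≟ v)) ×-dec
      Finₚ.all? (λ u → Finₚ.all? λ v → Adj? H u v →-dec Adj? G (e u) (e v)) ×-dec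
      Finₚ.all? (λ u → Finₚ.all? λ v → Finₚ.all? λ x → Finₚ.all? λ y →
        Adj? H u v →-dec Adj? H x y →-dec (c (e u) (e v) ℕ.≟ c (e x) (e y)) →-dec
        sameEdge? Fin._≟_ (u , v) (x , y))

    isRainbowCopy-resp : ∀ {c d} e → d ⇛ c → IsRainbowCopy c e → IsRainbowCopy d e
    isRainbowCopy-resp e from (inj , pres , rb) =
      inj , pres , λ u v x y uv xy eq → rb u v x y uv xy (apply from eq)

    isRainbowCopy-cong : ∀ c {e f} → e ≗ f → IsRainbowCopy c e → IsRainbowCopy c f
    isRainbowCopy-cong c e≗f (inj , pres , rb) =
      (λ u v eq → inj u v (trans (e≗f u) (trans eq (sym (e≗f v))))) ,
      (λ u v uv → subst₂ (Adj G) (e≗f u) (e≗f v) (pres u v uv)) ,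
      (λ u v x y uv xy eq → rb u v x y uv xy (trans (cong₂ c (e≗f u) (e≗f v))
        (trans eq (sym (cong₂ c (e≗f x) (e≗f y))))))

    rainbowCopy? : ∀ c → Dec (∃ (IsRainbowCopy c))
    rainbowCopy? c = any-fun? (isRainbowCopy-cong c) (isRainbowCopy? c)

    toCopy : (c : ProperColouring G) → ∃ (IsRainbowCopy (colour c)) → ContainsRainbow H c
    toCopy c (e , inj , pres , rb) =
      record { embed = e ; injective = λ {u} {v} → inj u v ; preserves = λ {u} {v} → pres u v } ,
      λ {u} {v} {x} {y} → rb u v x y

    fromCopy : (c : ProperColouring G) → ContainsRainbow H c → ∃ (IsRainbowCopy (colour c))
    fromCopy c (φ , rb) = Copy.embed φ , (λ _ _ → Copy.injective φ) ,
      (λ _ _ → Copy.preserves φ) , λ _ _ _ _ → rb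

    -- Search for a proper colouring from the finite palette without a rainbow copy. If there is
    -- none, `normalise` carries the conclusion over to all colourings.
    forces? : Dec (ForcesRainbow G H)
    forces? = map′ forced unforced (¬? bad?)
      where
      Bad : (Vertex G → Vertex G → Fin (Graph.order G * Graph.order G)) → Set
      Bad f = IsProper (numbered f) × ¬ ∃ (IsRainbowCopy (numbered f))
      transport : ∀ {f g : Vertex G → Vertex G → Fin (Graph.order G * Graph.order G)} →
                  (∀ u → f u ≗ g u) → numbered f ⇛ numbered g
      transport f≗g = refines λ eq →
        trans (cong toℕ (sym (f≗g _ _))) (trans eq (cong toℕ (f≗g _ _)))
      bad? : Dec (∃ Bad)
      bad? = any-fun₂?
        (λ f≗g (prop , none) →
          isProper-resp (transport f≗g) (transport (λ u → sym ∘ f≗g u)) prop ,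
          λ (e , rb) → none (e , isRainbowCopy-resp e (transport f≗g) rb))
        (λ f → isProper? (numbered f) ×-dec ¬? (rainbowCopy? (numbered f)))
      forced : ¬ ∃ Bad → ForcesRainbow G H
      forced none c with normalise (colour c)
      ... | f , to , from = toCopy c (e , isRainbowCopy-resp e to rb)
        where
        found : ∃ (IsRainbowCopy (numbered f))
        found = decidable-stable (rainbowCopy? (numbered f)) (λ ¬rb → none (f ,
          isProper-resp to from (colour-sym c , λ _ _ _ → proper c) , ¬rb))
        e  = proj₁ found
        rb = proj₂ found
      unforced : ForcesRainbow G H → ¬ ∃ Bad
      unforced forces (f , prop , none) = none (fromCopy c (forces c))
        where c = toProper (numbered f) prop

-- Dropping isolated vertices, and existence of the minimum

NoIsolated : Graph → Set
NoIsolated H = ∀ u → ∃[ v ] Adj H u v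

-- K is G up to isolated vertices.
module Core (G K : Graph) (e : Vertex K → Vertex G) (e-injective : Injective _≡_ _≡_ e)
            (to : ∀ {i j} → Adj K i j → Adj G (e i) (e j))
            (from : ∀ {i j} → Adj G (e i) (e j) → Adj K i j)
            (cover : ∀ {u v} → Adj G u v → ∃[ i ] e i ≡ u) where

  size-≤ : size K ≤ size G
  size-≤ = subst (_≤ size G) (length-map e₂ (Graph.edges K)) (length≤size G
    (AllPairsₚ.map⁺ {f = e₂} (AllPairs.map (λ distinct → distinct ∘ e₂-reflects) (edges-distinct K)))
    (Allₚ.map⁺ {f = e₂} (All.map to (edges-adjacent K))))
    where
    e₂ : Vertex K × Vertex K → Vertex G × Vertex G
    e₂ (i , j) = e i , e j
    e₂-reflects : ∀ {a b} → SameEdge (e₂ a) (e₂ b) → SameEdge a b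
    e₂-reflects (inj₁ (p , q)) = inj₁ (e-injective p , e-injective q)
    e₂-reflects (inj₂ (p , q)) = inj₂ (e-injective p , e-injective q)

  module _ (c : ProperColouring K) where

    private
      Preimage : Vertex G → Set
      Preimage u = ∃[ i ] e i ≡ u
      preimage? : ∀ u → Dec (Preimage u)
      preimage? u = Finₚ.any? (λ i → e i Fin.≟ u)
      pull : ∀ {u v} → Dec (Preimage u) → Dec (Preimage v) → ℕ
      pull (yes (i , _)) (yes (j , _)) = colour c i j
      -- A default: by `cover`, no edge of `G` has an end outside the image of `e`.
      pull (yes _)       (no _)        = 0
      pull (no _)        _             = 0

    extendColouring : ProperColouring G
    extendColouring .colour u v = pull (preimage? u) (preimage? v)
    extendColouring .colour-sym u v with preimage? u | preimage? v
    ... | yes _ | yes _ = colour-sym c _ _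
    ... | yes _ | no  _ = refl
    ... | no  _ | yes _ = refl
    ... | no  _ | no  _ = refl
    extendColouring .proper {u} {v} {w} uv uw v≢w eq
      with preimage? u | preimage? v | preimage? w
    ... | yes (_ , refl) | yes (_ , refl) | yes (_ , refl) =
          proper c (from uv) (from uw) (v≢w ∘ cong e) eq
    ... | no none | _       | _       = none (cover uv)
    ... | yes _   | no none | _       = none (cover (Adj-sym G uv))
    ... | yes _   | yes _   | no none = none (cover (Adj-sym G uw))

    extendColouring-e : ∀ i j → colour extendColouring (e i) (e j) ≡ colour c i j
    extendColouring-e i j with preimage? (e i) | preimage? (e j)
    ... | yes (_ , p) | yes (_ , q) = cong₂ (colour c) (e-injective p) (e-injective q)
    ... | yes _       | no none     = contradiction (j , refl) none
    ... | no none     | _           = contradiction (i , refl) none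

  -- Each vertex of `H` has a neighbour, so a rainbow copy in `G` lies in the image of `e` and can
  -- be pulled back.
  forces : ∀ {H} → NoIsolated H → ForcesRainbow G H → ForcesRainbow K H
  forces {H} noIsolated forcesG c with forcesG (extendColouring c)
  ... | φ , rb = record
    { embed     = e⁻¹
    ; injective = λ {u} {v} eq → injective (trans (sym (e∘e⁻¹ u)) (trans (cong e eq) (e∘e⁻¹ v)))
    ; preserves = λ {u} {v} uv → from (subst₂ (Adj G) (sym (e∘e⁻¹ u)) (sym (e∘e⁻¹ v)) (preserves uv))
    } , λ {u} {v} {x} {y} uv xy eq → rb uv xy (trans (same u v) (trans eq (sym (same x y))))
    where
    open Copy φ
    hit : ∀ u → ∃[ i ] e i ≡ embed u
    hit u = cover (preserves (proj₂ (noIsolated u)))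
    e⁻¹ : Vertex H → Vertex K
    e⁻¹ u = proj₁ (hit u)
    e∘e⁻¹ : ∀ u → e (e⁻¹ u) ≡ embed u
    e∘e⁻¹ u = proj₂ (hit u)
    same : ∀ u v → colour (extendColouring c) (embed u) (embed v) ≡ colour c (e⁻¹ u) (e⁻¹ v)
    same u v = trans (cong₂ (colour (extendColouring c)) (sym (e∘e⁻¹ u)) (sym (e∘e⁻¹ v)))
      (extendColouring-e c (e⁻¹ u) (e⁻¹ v))

-- Ignoring the diagonal and asking for a 1 on both sides of it makes every matrix a graph, so a
-- search over functions is a search over graphs.
matrixGraph : ∀ {n} → (Fin n → Fin n → Fin 2) → Graph
matrixGraph {n} f = record
  { order      = n
  ; Adj        = λ u v → u ≢ v × f u v ≡ one × f v u ≡ one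
  ; Adj?       = λ u v → ¬? (u Fin.≟ v) ×-dec (f u v Fin.≟ one) ×-dec (f v u Fin.≟ one)
  ; Adj-sym    = λ (u≢v , p , q) → ≢-sym u≢v , q , p
  ; Adj-irrefl = λ u≡v (u≢v , _) → u≢v u≡v
  }
  where
  one : Fin 2
  one = Fin.suc Fin.zero

-- The bound on `n` makes this decidable; it is the number of ends that `m` edges can have.
Realisable : Graph → ℕ → Set
Realisable H m = ∃[ n ] (n < suc (2 * m) × ∃[ f ] (size (matrixGraph {n} f) ≤ m ×
                                                   ForcesRainbow (matrixGraph f) H))

module _ {H : Graph} (noIsolated : NoIsolated H) where

  realisable? : ∀ m → Dec (Realisable H m)
  realisable? m = ℕₚ.anyUpTo? (λ n → any-fun₂?
    (λ {f} {g} f≗g (small , forcesF) →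
      -- Matrices that agree pointwise give the same graph: `Core` with `id`.
      let open Core (matrixGraph f) (matrixGraph g) id id
                (λ (u≢v , p , q) → u≢v , trans (f≗g _ _) p , trans (f≗g _ _) q)
                (λ (u≢v , p , q) → u≢v , trans (sym (f≗g _ _)) p , trans (sym (f≗g _ _)) q)
                (λ {u} _ → u , refl)
      in ℕₚ.≤-trans size-≤ small , forces noIsolated forcesF)
    (λ f → (size (matrixGraph f) ℕ.≤? m) ×-dec forces? (matrixGraph f) H)) (suc (2 * m))

  -- The vertices kept are the ends of the edges of `G`, listed without repetition.
  realise : ∀ G → ForcesRainbow G H → Realisable H (size G)
  realise G forcesG = length support , s≤s support-length , f , size-≤ , forces noIsolated forcesG
    where
    E : List (Vertex G × Vertex G)
    E = Graph.edges G
    ends support : List (Vertex G)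
    ends    = map proj₁ E ++ map proj₂ E
    support = deduplicate Fin._≟_ ends
    support-length : length support ≤ 2 * size G
    support-length = ℕₚ.≤-trans (length-deduplicate Fin._≟_ ends) (ℕₚ.≤-reflexive
      (trans (length-++ (map proj₁ E)) (cong₂ _+_ (length-map proj₁ E)
        (trans (length-map proj₂ E) (sym (ℕₚ.+-identityʳ _))))))
    e : Fin (length support) → Vertex G
    e = lookup support
    clash : ∀ {i j} → i Fin.< j → e i ≢ e j
    clash = AllPairs-lookup (deduplicate-! Fin._≟_ ends)
    e-injective : Injective _≡_ _≡_ e
    e-injective {i} {j} eq with Finₚ.<-cmp i j
    ... | tri< i<j _ _ = contradiction eq (clash i<j)
    ... | tri≈ _ i≡j _ = i≡j
    ... | tri> _ _ j<i = contradiction (sym eq) (clash j<i)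
    f : Fin (length support) → Fin (length support) → Fin 2
    f i j with Adj? G (e i) (e j)
    ... | yes _ = Fin.suc Fin.zero
    ... | no  _ = Fin.zero
    f-adj : ∀ {i j} → Adj G (e i) (e j) → f i j ≡ Fin.suc Fin.zero
    f-adj {i} {j} ij with Adj? G (e i) (e j)
    ... | yes _ = refl
    ... | no ¬ij = contradiction ij ¬ij
    adj-f : ∀ {i j} → f i j ≡ Fin.suc Fin.zero → Adj G (e i) (e j)
    adj-f {i} {j} eq with Adj? G (e i) (e j)
    ... | yes ij = ij
    end : ∀ {u v} {es : List (Vertex G × Vertex G)} → Any (SameEdge (u , v)) es →
          u ∈ map proj₁ es ++ map proj₂ es
    end {es = es} any with Anyₚ.lookup-index any
    ... | inj₁ (u≡ , _) = ∈-++⁺ˡ (subst (_∈ map proj₁ es) (sym u≡)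
            (∈-map⁺ proj₁ (∈-lookup (Any.index any))))
    ... | inj₂ (u≡ , _) = ∈-++⁺ʳ (map proj₁ es) (subst (_∈ map proj₂ es) (sym u≡)
            (∈-map⁺ proj₂ (∈-lookup (Any.index any))))
    cover : ∀ {u v} → Adj G u v → ∃[ i ] e i ≡ u
    cover uv = Any.index u∈ , sym (Anyₚ.lookup-index u∈)
      where u∈ = ∈-deduplicate⁺ Fin._≟_ (end (edges-complete G uv))
    open Core G (matrixGraph f) e e-injective (λ (_ , p , _) → adj-f p)
      (λ ij → (λ i≡j → Adj-irrefl G (cong e i≡j) ij) , f-adj ij , f-adj (Adj-sym G ij)) cover

  -- The witness `K` of the least realisable `m` has exactly `m` edges, since `size K` is itself
  -- realisable.
  existsAR : ∀ G → ForcesRainbow G H → ∃[ m ] (IsARₛ H m × m ≤ size G)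
  existsAR G forcesG = fromLeast (least realisable? (size G) (realise G forcesG))
    where
    fromLeast : ∃[ m ] (Realisable H m × (∀ i → Realisable H i → m ≤ i)) →
                ∃[ m ] (IsARₛ H m × m ≤ size G)
    fromLeast (m , (n , _ , f , small , forces) , minimal) = m , record
      { attained = K , ℕₚ.≤-antisym small (minimal (size K) (realise K forces)) , forces
      ; minimal  = λ G′ forcesG′ → minimal (size G′) (realise G′ forcesG′)
      } , minimal (size G) (realise G forcesG)
      where
      K : Graph
      K = matrixGraph f

-- Upper bounds: greedy choices in blown-up graphs

-- Loops in `L` are dropped and repetitions count once, hence the inequality in `size-listGraph`.
listGraph : ∀ {n} → List (Fin n × Fin n) → Graph
listGraph {n} L = record
  { order      = n
  ; Adj        = λ u v → u ≢ v × Any (SameEdge (u , v)) L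
  ; Adj?       = λ u v → ¬? (u Fin.≟ v) ×-dec Any.any? (sameEdge? Fin._≟_ (u , v)) L
  ; Adj-sym    = λ (u≢v , uv) → ≢-sym u≢v , Any.map SameEdge-swapˡ uv
  ; Adj-irrefl = λ u≡v (u≢v , _) → u≢v u≡v
  }

listGraph-adj : ∀ {n} {L : List (Fin n × Fin n)} {u v} → u ≢ v → (u , v) ∈ L →
                Adj (listGraph L) u v
listGraph-adj u≢v uv∈L = u≢v , Any.map (λ { refl → inj₁ (refl , refl) }) uv∈L

size-listGraph : ∀ {n} (L : List (Fin n × Fin n)) → size (listGraph L) ≤ length L
size-listGraph L = size≤length (listGraph L) proj₂

-- For each `τ` a used colour excludes at most one candidate, so one candidate more than
-- `t * length used` suffices. If all failed, pairs of `τ` and a position in `used` would encode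
-- them injectively.
avoid : ∀ {t} (used : List ℕ) (f : ℕ → Fin t → ℕ) →
        (∀ τ {i j} → i < suc (t * length used) → j < suc (t * length used) →
         f i τ ≡ f j τ → i ≡ j) →
        ∃[ j ] (j < suc (t * length used) × ∀ τ → f j τ ∉ used)
avoid {t} used f f-injective
  with Finₚ.any? (λ (j : Fin (suc (t * length used))) → Finₚ.all? λ τ → ¬? (f (toℕ j) τ ∈? used))
... | yes (j , good) = toℕ j , Finₚ.toℕ<n j , good
... | no  none       = contradiction (Finₚ.injective⇒≤ (λ {i} {j} → encode-injective (hit i) (hit j))) (ℕₚ.<⇒≱ ℕₚ.≤-refl)
  where
  Hit : Fin (suc (t * length used)) → Set
  Hit j = ∃[ τ ] f (toℕ j) τ ∈ used
  hit : ∀ j → Hit j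
  hit j with Finₚ.¬∀⟶∃¬ t _ (λ τ → ¬? (f (toℕ j) τ ∈? used)) (λ good → none (j , good))
  ... | τ , ¬∉ = τ , decidable-stable (f (toℕ j) τ ∈? used) ¬∉
  encode : ∀ {j} → Hit j → Fin (t * length used)
  encode (τ , ∈used) = combine τ (Any.index ∈used)
  encode-injective : ∀ {i j} (p : Hit i) (q : Hit j) → encode p ≡ encode q → i ≡ j
  encode-injective {i} {j} (σ , i∈) (τ , j∈) eq
    with refl , same ← Finₚ.combine-injective σ (Any.index i∈) τ (Any.index j∈) eq =
    Finₚ.toℕ-injective (f-injective τ (Finₚ.toℕ<n i) (Finₚ.toℕ<n j)
      (trans (Anyₚ.lookup-index i∈)
        (trans (cong (lookup used) same) (sym (Anyₚ.lookup-index j∈)))))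

length-cartesianProductWith : {C : Set} (f : A → B → C) (xs : List A) (ys : List B) →
                              length (cartesianProductWith f xs ys) ≡ length xs * length ys
length-cartesianProductWith f []       ys = refl
length-cartesianProductWith f (x ∷ xs) ys = trans (length-++ (map (f x) ys))
  (cong₂ _+_ (length-map (f x) ys) (length-cartesianProductWith f xs ys))

-- Enough candidates for a round that adds t colours when e colours are
-- forbidden from the start and n rounds have been played.
slots : ℕ → ℕ → ℕ → ℕ
slots t e n = suc (t * (e + n * t))

-- `F i j τ` is the colour of edge `τ` gained by choosing candidate `j` in round `i`; `U` lists the
-- colours forbidden from the start.
record Choice {t} (e m : ℕ) (F : ℕ → ℕ → Fin t → ℕ) (U : List ℕ) : Set where
  field
    pick     : ℕ → ℕ
    -- The rounds from `suc i` up to `m - 1` precede round `i`.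
    pick<    : ∀ {i} → i < m → pick i < slots t e (m ∸ suc i)
    -- Spokes end in vertex 0 of a row, so 0 is the default where nothing is chosen.
    pick-0   : ∀ {i} → m ≤ i → pick i ≡ 0
    distinct : ∀ {i j σ τ} → i < m → j < m → F i (pick i) σ ≡ F j (pick j) τ → i ≡ j × σ ≡ τ
    fresh    : ∀ {i} τ → i < m → F i (pick i) τ ∉ U

open Choice

-- The rounds are played from the last to the first.
greedy : ∀ {t e} m (F : ℕ → ℕ → Fin t → ℕ) (U : List ℕ) → length U ≡ e →
         (∀ {i} → i < m → ∀ τ {j l} → j < slots t e (m ∸ suc i) → l < slots t e (m ∸ suc i) →
          F i j τ ≡ F i l τ → j ≡ l) →
         (∀ {i} → i < m → ∀ {j} → j < slots t e (m ∸ suc i) → ∀ {σ τ} →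
          F i j σ ≡ F i j τ → σ ≡ τ) →
         Choice e m F U
greedy zero F U _ _ _ = record
  { pick = λ _ → 0 ; pick< = λ () ; pick-0 = λ _ → refl ; distinct = λ () ; fresh = λ _ () }
greedy {t} {e} (suc m) F U |U|≡e F-injʲ F-injᵗ = record
  { pick     = λ { zero → j₀ ; (suc i) → pick later i }
  ; pick<    = λ { {zero} _ → j₀< ; {suc i} i<m → pick< later (s<s⁻¹ i<m) }
  ; pick-0   = λ { {suc i} m≤i → pick-0 later (s≤s⁻¹ m≤i) }
  ; distinct = λ
    { {zero}  {zero}  _ _ eq → refl , F-injᵗ (s≤s z≤n) j₀< eq
    ; {zero}  {suc j} {σ} {τ} _ j<m eq →
        contradiction (subst (_∈ used) (sym eq) (seen τ (s<s⁻¹ j<m))) (j₀-good σ)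
    ; {suc i} {zero}  {σ} {τ} i<m _ eq →
        contradiction (subst (_∈ used) eq (seen σ (s<s⁻¹ i<m))) (j₀-good τ)
    ; {suc i} {suc j} i<m j<m eq →
        let i≡j , σ≡τ = distinct later (s<s⁻¹ i<m) (s<s⁻¹ j<m) eq in cong suc i≡j , σ≡τ
    }
  ; fresh    = λ { {zero}  τ _ ∈U   → j₀-good τ (∈-++⁺ˡ ∈U)
                 ; {suc i} τ i<m ∈U → fresh later τ (s<s⁻¹ i<m) ∈U }
  }
  where
  later : Choice e m (F ∘ suc) U
  later = greedy m (F ∘ suc) U |U|≡e (F-injʲ ∘ s<s) (F-injᵗ ∘ s<s)
  -- The forbidden colours and those of the rounds already played, `e + m * t` in total.
  colours used : List ℕ
  colours = cartesianProductWith (λ i → F (suc i) (pick later i)) (upTo m) (allFin t)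
  used    = U ++ colours
  seen : ∀ {i} τ → i < m → F (suc i) (pick later i) τ ∈ used
  seen τ i<m = ∈-++⁺ʳ U (∈-cartesianProductWith⁺ _ (∈-upTo⁺ i<m) (∈-allFin τ))
  length-used : suc (t * length used) ≡ slots t e m
  length-used = cong (λ l → suc (t * l)) (trans (length-++ U) (cong₂ _+_ |U|≡e
    (trans (length-cartesianProductWith _ (upTo m) (allFin t))
      (cong₂ _*_ (length-applyUpTo id m) (length-tabulate id)))))
  shrink : ∀ {j} → j < suc (t * length used) → j < slots t e m
  shrink {j} = subst (j <_) length-used
  new : ∃[ j ] (j < suc (t * length used) × ∀ τ → F 0 j τ ∉ used)
  new = avoid used (F 0) (λ τ i< j< → F-injʲ (s≤s z≤n) τ (shrink i<) (shrink j<))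
  j₀ : ℕ
  j₀ = proj₁ new
  j₀< : j₀ < slots t e m
  j₀< = shrink (proj₁ (proj₂ new))
  j₀-good : ∀ τ → F 0 j₀ τ ∉ used
  j₀-good = proj₂ (proj₂ new)

-- Row `i` has `N (m ∸ suc i)` entries, matching the reversed order of the rounds.
fan : (ℕ → ℕ) → ℕ → (ℕ → ℕ → A) → List A
fan N zero    f = []
fan N (suc m) f = applyUpTo (f 0) (N m) ++ fan N m (f ∘ suc)

∈-fan : ∀ N m (f : ℕ → ℕ → A) {i j} → i < m → j < N (m ∸ suc i) → f i j ∈ fan N m f
∈-fan N (suc m) f {zero}  _   j<N = ∈-++⁺ˡ (∈-applyUpTo⁺ (f 0) j<N)
∈-fan N (suc m) f {suc i} i<m j<N = ∈-++⁺ʳ _ (∈-fan N m (f ∘ suc) (s<s⁻¹ i<m) j<N)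

∑< : ℕ → (ℕ → ℕ) → ℕ
∑< zero    N = 0
∑< (suc m) N = N m + ∑< m N

length-fan : ∀ N m (f : ℕ → ℕ → A) → length (fan N m f) ≡ ∑< m N
length-fan N zero    f = refl
length-fan N (suc m) f = trans (length-++ (applyUpTo (f 0) (N m)))
  (cong₂ _+_ (length-applyUpTo (f 0) (N m)) (length-fan N m (f ∘ suc)))

length-concat-tabulate : ∀ {t l} (f : Fin t → List A) → (∀ τ → length (f τ) ≡ l) →
                         length (concat (tabulate f)) ≡ t * l
length-concat-tabulate {t = zero}  f _  = refl
length-concat-tabulate {t = suc t} f |f| = trans (length-++ (f Fin.zero))
  (cong₂ _+_ (|f| Fin.zero) (length-concat-tabulate (f ∘ Fin.suc) (|f| ∘ Fin.suc)))

-- The vertices form R rows.  In round i < m some vertex j of row b i is chosen;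
-- it is joined to vertex 0 of each of the t rows h i τ.  Each pair in X is
-- an additional edge between the first vertices of two rows.
module Fans {R m t : ℕ} (b : ℕ → Fin R) (h : ℕ → Fin t → Fin R)
            (X : List (Fin R × Fin R)) {e : ℕ} (|X|≡e : length X ≡ e)
            (b≢h : ∀ {i} → i < m → ∀ τ → b i ≢ h i τ)
            (h-injective : ∀ {i} → i < m → ∀ {σ τ} → h i σ ≡ h i τ → σ ≡ τ) where

  -- One width for all rows, so that a vertex is a row with a column. Places without edges are
  -- isolated and do not affect `size`.
  width : ℕ
  width = slots t e m

  at : Fin R → ℕ → Fin (R * width)
  at r j = combine r (j mod width)

  at-row : ∀ {r s} i j → at r i ≡ at s j → r ≡ s
  at-row {r} {s} i j = Finₚ.combine-injectiveˡ r (i mod width) s (j mod width)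

  at-column : ∀ {r i j} → i < width → j < width → at r i ≡ at r j → i ≡ j
  at-column {r} {i} {j} i< j< eq = trans (sym (toℕ-mod i<)) (trans
    (cong toℕ (Finₚ.combine-injectiveʳ r (i mod width) r (j mod width) eq)) (toℕ-mod j<))
    where
    toℕ-mod : ∀ {i} → i < width → toℕ (i mod width) ≡ i
    toℕ-mod {i} i< = trans (Finₚ.toℕ-fromℕ< (m%n<n i width)) (m<n⇒m%n≡m i<)

  spoke : ℕ → ℕ → Fin t → Fin (R * width) × Fin (R * width)
  spoke i j τ = at (b i) j , at (h i τ) 0

  chord : Fin R × Fin R → Fin (R * width) × Fin (R * width)
  chord (x , y) = at x 0 , at y 0

  spokes : Fin t → List (Fin (R * width) × Fin (R * width))
  spokes τ = fan (slots t e) m (λ i j → spoke i j τ)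

  edgeList : List (Fin (R * width) × Fin (R * width))
  edgeList = map chord X ++ concat (tabulate spokes)

  graph : Graph
  graph = listGraph edgeList

  size-graph : size graph ≤ e + t * ∑< m (slots t e)
  size-graph = ℕₚ.≤-trans (size-listGraph edgeList) (ℕₚ.≤-reflexive
    (trans (length-++ (map chord X)) (cong₂ _+_ (trans (length-map chord X) |X|≡e)
      (length-concat-tabulate spokes (λ τ → length-fan (slots t e) m _)))))

  chord-adj : ∀ {x y} → x ≢ y → (x , y) ∈ X → Adj graph (at x 0) (at y 0)
  chord-adj x≢y xy∈X = listGraph-adj (x≢y ∘ at-row 0 0) (∈-++⁺ˡ (∈-map⁺ chord xy∈X))

  spoke-adj : ∀ {i j} → i < m → j < slots t e (m ∸ suc i) → ∀ τ →
              Adj graph (at (b i) j) (at (h i τ) 0)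
  spoke-adj {j = j} i<m j< τ = listGraph-adj (b≢h i<m τ ∘ at-row j 0) (∈-++⁺ʳ _
    (∈-concat⁺′ (∈-fan (slots t e) m _ i<m j<) (∈-tabulate⁺ τ)))

  slots≤width : ∀ i → slots t e (m ∸ suc i) ≤ width
  slots≤width i = s≤s (ℕₚ.*-monoʳ-≤ t (ℕₚ.+-monoʳ-≤ e (ℕₚ.*-monoˡ-≤ t (ℕₚ.m∸n≤m m (suc i)))))

  -- Properness yields both injectivity hypotheses of `greedy`: spokes with the same `τ` meet in
  -- vertex 0 of row `h i τ`, and the spokes of one candidate meet in that candidate.
  choose : (c : ProperColouring graph) →
           Choice e m (λ i j τ → uncurry (colour c) (spoke i j τ))
                      (map (uncurry (colour c) ∘ chord) X)
  choose c = greedy m _ _ (trans (length-map _ X) |X|≡e)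
    (λ {i} i<m τ {j} {l} j< l< eq → decidable-stable (j ℕ.≟ l) λ j≢l →
      proper c (Adj-sym graph (spoke-adj i<m j< τ)) (Adj-sym graph (spoke-adj i<m l< τ))
        (j≢l ∘ at-column (ℕₚ.≤-trans j< (slots≤width i)) (ℕₚ.≤-trans l< (slots≤width i)))
        (trans (colour-sym c _ _) (trans eq (colour-sym c _ _))))
    (λ i<m j< {σ} {τ} eq → decidable-stable (σ Fin.≟ τ) λ σ≢τ →
      proper c (spoke-adj i<m j< σ) (spoke-adj i<m j< τ) (σ≢τ ∘ h-injective i<m ∘ at-row 0 0) eq)

-- For an orientation R of H with out-degrees at most one, distinct colours
-- only need to be checked on arcs with distinct tails.
rainbowCopy : ∀ {H G} (c : ProperColouring G) (R : Rel (Vertex H) 0ℓ) →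
              (∀ {u v} → Adj H u v → SymClosure R u v) →
              (∀ {u v w} → R u v → R u w → v ≡ w) →
              (e : Vertex H → Vertex G) → Injective _≡_ _≡_ e →
              (∀ {u v} → R u v → Adj G (e u) (e v)) →
              (∀ {u v x y} → R u v → R x y →
               colour c (e u) (e v) ≡ colour c (e x) (e y) → u ≡ x) →
              ContainsRainbow H c
rainbowCopy {H} {G} c R arc functional e e-injective e-adj tails =
  record { embed = e ; injective = e-injective ; preserves = adj ∘ arc } ,
  λ uv xy → rainbow (arc uv) (arc xy)
  where
  adj : ∀ {u v} → SymClosure R u v → Adj G (e u) (e v)
  adj (fwd uv) = e-adj uv
  adj (bwd vu) = Adj-sym G (e-adj vu)
  same : ∀ {u v x y} → R u v → R x y → colour c (e u) (e v) ≡ colour c (e x) (e y) → u ≡ x × v ≡ y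
  same uv xy eq with tails uv xy eq
  ... | refl = refl , functional uv xy
  swap : ∀ u v → colour c (e u) (e v) ≡ colour c (e v) (e u)
  swap u v = colour-sym c (e u) (e v)
  rainbow : ∀ {u v x y} → SymClosure R u v → SymClosure R x y →
            colour c (e u) (e v) ≡ colour c (e x) (e y) → (u ≡ x × v ≡ y) ⊎ (u ≡ y × v ≡ x)
  rainbow (fwd uv) (fwd xy) eq = inj₁ (same uv xy eq)
  rainbow (fwd uv) (bwd yx) eq = inj₂ (same uv yx (trans eq (swap _ _)))
  rainbow (bwd vu) (fwd xy) eq with same vu xy (trans (swap _ _) eq)
  ... | v≡x , u≡y = inj₂ (u≡y , v≡x)
  rainbow (bwd vu) (bwd yx) eq with same vu yx (trans (swap _ _) (trans eq (swap _ _)))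
  ... | v≡y , u≡x = inj₁ (u≡x , v≡y)

-- Residues modulo `k`

module _ {k : ℕ} .{{_ : NonZero k}} where

  toℕ-mod : ∀ p → toℕ (p mod k) ≡ p % k
  toℕ-mod p = Finₚ.toℕ-fromℕ< (m%n<n p k)

  toℕ-mod< : ∀ {p} → p < k → toℕ (p mod k) ≡ p
  toℕ-mod< {p} p<k = trans (toℕ-mod p) (m<n⇒m%n≡m p<k)

  mod-toℕ : (u : Fin k) → toℕ u mod k ≡ u
  mod-toℕ u = Finₚ.toℕ-injective (toℕ-mod< (Finₚ.toℕ<n u))

  -- Below `k` the shifted value exceeds `p`; otherwise its residue is that of `suc d + p ∸ k`,
  -- which is smaller than `p`.
  mod-shift : ∀ {d p} → suc d < k → p < k → (suc d + p) mod k ≢ p mod k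
  mod-shift {d} {p} d<k p<k eq = differs (ℕₚ.<-≤-connex (suc d + p) k)
    where
    eq′ : (suc d + p) % k ≡ p
    eq′ = trans (sym (toℕ-mod (suc d + p))) (trans (cong toℕ eq) (toℕ-mod< p<k))
    differs : ¬ (suc d + p < k ⊎ k ≤ suc d + p)
    differs (inj₁ small) = ℕₚ.m≢1+n+m p (trans (sym eq′) (m<n⇒m%n≡m small))
    differs (inj₂ large) = ℕₚ.<⇒≢ below (trans (sym (m<n⇒m%n≡m (ℕₚ.<-trans below p<k)))
      (trans (m≤n⇒[n∸m]%m≡n%m large) eq′))
      where
      below : suc d + p ∸ k < p
      below = ℕₚ.+-cancelʳ-< k _ _ (subst₂ _<_ (sym (ℕₚ.m∸n+n≡m large)) (ℕₚ.+-comm k p)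
        (ℕₚ.+-monoˡ-< p d<k))

-- Disjoint stars and the value for matchings

-- Star `i < k` has its `k ∸ i` leaves in row `i` and its centre in row `k + i`.
module Stars (k : ℕ) .{{_ : NonZero (k + k)}} where

  rung≢ : ∀ {i} → i < k → i mod (k + k) ≢ (k + i) mod (k + k)
  rung≢ {i} i<k eq = ℕₚ.<⇒≢ (ℕₚ.≤-trans i<k (ℕₚ.m≤m+n k i))
    (trans (sym (toℕ-mod< (ℕₚ.≤-trans i<k (ℕₚ.m≤m+n k k))))
      (trans (cong toℕ eq) (toℕ-mod< (ℕₚ.+-monoʳ-< k i<k))))

  Fin1-unique : (σ τ : Fin 1) → σ ≡ τ
  Fin1-unique Fin.zero Fin.zero = refl

  open Fans {t = 1} (_mod (k + k)) (λ i _ → (k + i) mod (k + k)) [] refl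
    (λ i<k _ → rung≢ i<k) (λ _ {σ} {τ} _ → Fin1-unique σ τ) public

  forces-matching : ForcesRainbow graph (matching k)
  forces-matching c = rainbowCopy c (λ u v → toℕ v ≡ k + toℕ u) id
    (λ v≡ w≡ → Finₚ.toℕ-injective (trans v≡ (sym w≡)))
    e (λ {u} {v} → at-row (s (toℕ u)) (s (toℕ v))) e-adj tails
    where
    leaf : Choice _ k _ _
    leaf = choose c
    s : ℕ → ℕ
    s = pick leaf
    -- From `k` on, `pick-0` makes this the centre of a star.
    e : Fin (k + k) → Vertex graph
    e u = at u (s (toℕ u))
    tail< : ∀ {u v : Fin (k + k)} → toℕ v ≡ k + toℕ u → toℕ u < k
    tail< {u} {v} v≡ = ℕₚ.+-cancelˡ-< k _ _ (subst (_< k + k) v≡ (Finₚ.toℕ<n v))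
    e-tail : ∀ u → e u ≡ at (toℕ u mod (k + k)) (s (toℕ u))
    e-tail u = cong (λ r → at r (s (toℕ u))) (sym (mod-toℕ u))
    e-head : ∀ {u v : Fin (k + k)} → toℕ v ≡ k + toℕ u → e v ≡ at ((k + toℕ u) mod (k + k)) 0
    e-head {u} {v} v≡ = cong₂ at (trans (sym (mod-toℕ v)) (cong (_mod (k + k)) v≡))
      (pick-0 leaf (subst (k ≤_) (sym v≡) (ℕₚ.m≤m+n k (toℕ u))))
    e-adj : ∀ {u v : Fin (k + k)} → toℕ v ≡ k + toℕ u → Adj graph (e u) (e v)
    e-adj {u} {v} v≡ = subst₂ (Adj graph) (sym (e-tail u)) (sym (e-head {u} {v} v≡))
      (spoke-adj (tail< {u} {v} v≡) (pick< leaf (tail< {u} {v} v≡)) Fin.zero)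
    tails : ∀ {u v x y : Fin (k + k)} → toℕ v ≡ k + toℕ u → toℕ y ≡ k + toℕ x →
            colour c (e u) (e v) ≡ colour c (e x) (e y) → u ≡ x
    tails {u} {v} {x} {y} v≡ y≡ eq = Finₚ.toℕ-injective (proj₁ (distinct leaf
      {σ = Fin.zero} {τ = Fin.zero} (tail< {u} {v} v≡) (tail< {x} {y} y≡)
      (subst₂ _≡_ (cong₂ (colour c) (e-tail u) (e-head {u} {v} v≡))
        (cong₂ (colour c) (e-tail x) (e-head {x} {y} y≡)) eq)))

-- The sum is 1 + 2 + ... + `k`, and Pascal's rule accounts for each new star.
∑-stars : ∀ k → ∑< k (slots 1 0) ≡ suc k C 2
∑-stars zero    = refl
∑-stars (suc k) = trans (cong₂ _+_ (trans (arith k) (sym (nC1≡n (suc k)))) (∑-stars k))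
  (nCk+nC[k+1]≡[n+1]C[k+1] (suc k) 1)
  where
  arith : ∀ n → suc (1 * (0 + n * 1)) ≡ suc n
  arith = solve-∀

twice-C2 : ∀ k → 2 * (suc k C 2) ≡ k * suc k
twice-C2 zero    = refl
twice-C2 (suc k) = trans (cong (2 *_) (trans (sym (nCk+nC[k+1]≡[n+1]C[k+1] (suc k) 1))
    (cong (_+ (suc k C 2)) (nC1≡n (suc k)))))
  (trans (ℕₚ.*-distribˡ-+ 2 (suc k) (suc k C 2))
    (trans (cong (_+_ (2 * suc k)) (twice-C2 k)) (arith k)))
  where
  arith : ∀ n → 2 * suc n + n * suc n ≡ suc n * suc (suc n)
  arith = solve-∀

-- Counting bounds the edges of the stars from above. Since the stars force the matching, the lower
-- bound applies to them too and gives equality.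
AR-matching : ∀ k .{{_ : NonZero (k + k)}} → IsARₛ (matching k) (suc k C 2)
AR-matching k = record
  { attained = graph , ℕₚ.≤-antisym
      (ℕₚ.≤-trans size-graph (ℕₚ.≤-reflexive (trans (ℕₚ.+-identityʳ _) (∑-stars k))))
      (lower graph forces-matching) , forces-matching
  ; minimal  = lower
  }
  where
  open Stars k
  lower : ∀ G → ForcesRainbow G (matching k) → suc k C 2 ≤ size G
  lower G forces = ℕₚ.*-cancelˡ-≤ 2 (subst (_≤ 2 * size G) (sym (twice-C2 k))
    (union-lower-bound 1 k G (matching-union G k forces)))

-- Rainbow cycles

data Parity : ℕ → Set where
  even : ∀ i → Parity (i * 2)
  odd  : ∀ i → Parity (suc (i * 2))

parity : ∀ n → Parity n
parity zero    = even 0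
parity (suc n) with parity n
... | even i = odd i
... | odd  i = even (suc i)

atOdd : (ℕ → ℕ) → ℕ → ℕ
atOdd s zero          = 0
atOdd s (suc zero)    = s 0
atOdd s (suc (suc n)) = atOdd (s ∘ suc) n

atOdd-even : ∀ s i → atOdd s (i * 2) ≡ 0
atOdd-even s zero    = refl
atOdd-even s (suc i) = atOdd-even (s ∘ suc) i

atOdd-odd : ∀ s i → atOdd s (suc (i * 2)) ≡ s i
atOdd-odd s zero    = refl
atOdd-odd s (suc i) = atOdd-odd (s ∘ suc) i

-- The even positions of the cycle carry one vertex each, the odd ones a row of
-- candidates; if k is odd, positions k - 1 and 0 are joined by a chord.
module CycleGraph (k : ℕ) .{{_ : NonZero k}} (3≤k : 3 ≤ k) (e m : ℕ) (e≤1 : e ≤ 1)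
                  (k≡ : k ≡ e + m * 2) where

  private
    row : ℕ → Fin k
    row p = p mod k

    -- The neighbours `2 i` and `2 i + 2` of position `2 i + 1`; for even `k` the last of them wraps
    -- around to 0.
    hub : ℕ → Fin 2 → Fin k
    hub i τ = row (toℕ τ * 2 + i * 2)

    X : List (Fin k × Fin k)
    X = replicate e (row (m * 2) , row 0)

    m*2≤k : m * 2 ≤ k
    m*2≤k = subst (m * 2 ≤_) (sym k≡) (ℕₚ.m≤n+m (m * 2) e)

    odd<k : ∀ {i} → i < m → suc (i * 2) < k
    odd<k i<m = ℕₚ.≤-trans (ℕₚ.*-monoˡ-≤ 2 i<m) m*2≤k

    even<k : ∀ {i} → i < m → i * 2 < k
    even<k i<m = ℕₚ.<-trans (ℕₚ.n<1+n _) (odd<k i<m)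

    0<k : 0 < k
    0<k = ℕₚ.<-trans (s≤s z≤n) 3≤k

    2≤k : 2 ≤ k
    2≤k = ℕₚ.≤-trans (ℕₚ.n≤1+n 2) 3≤k

    blob≢hub : ∀ {i} → i < m → ∀ τ → row (suc (i * 2)) ≢ hub i τ
    blob≢hub i<m Fin.zero           = mod-shift 2≤k (even<k i<m)
    blob≢hub i<m (Fin.suc Fin.zero) = ≢-sym (mod-shift 2≤k (odd<k i<m))

    hub-injective : ∀ {i} → i < m → ∀ {σ τ} → hub i σ ≡ hub i τ → σ ≡ τ
    hub-injective i<m {Fin.zero}         {Fin.zero}         _  = refl
    hub-injective i<m {Fin.zero}         {Fin.suc Fin.zero} eq =
      contradiction (sym eq) (mod-shift 3≤k (even<k i<m))
    hub-injective i<m {Fin.suc Fin.zero} {Fin.zero}         eq =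
      contradiction eq (mod-shift 3≤k (even<k i<m))
    hub-injective i<m {Fin.suc Fin.zero} {Fin.suc Fin.zero} _  = refl

  open Fans (λ i → row (suc (i * 2))) hub X (length-replicate e) blob≢hub hub-injective public

  module _ (c : ProperColouring graph) where

    private
      blob : Choice e m _ _
      blob = choose c

      s : ℕ → ℕ
      s = pick blob

      -- Positions are natural numbers, so the closing edge is the step from `k - 1` to `k`, and
      -- `v-wrap` identifies `k` with 0.
      v : ℕ → Vertex graph
      v p = at (row p) (atOdd s p)

      v-even : ∀ i → v (i * 2) ≡ at (row (i * 2)) 0
      v-even i = cong (at (row (i * 2))) (atOdd-even s i)

      v-odd : ∀ i → v (suc (i * 2)) ≡ at (row (suc (i * 2))) (s i)
      v-odd i = cong (at (row (suc (i * 2)))) (atOdd-odd s i)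

      v-wrap : v k ≡ v 0
      v-wrap = cong₂ at (Finₚ.toℕ-injective (trans (toℕ-mod k) (trans (n%n≡0 k) (sym (toℕ-mod< 0<k)))))
        (trans (cong (atOdd s) k≡) (last e≤1))
        where
        last : ∀ {e} → e ≤ 1 → atOdd s (e + m * 2) ≡ 0
        last z≤n       = atOdd-even s m
        -- For odd `k`, position `k` is `2 m + 1`, just beyond the last round.
        last (s≤s z≤n) = trans (atOdd-odd s m) (pick-0 blob ℕₚ.≤-refl)

      chordColours : List ℕ
      chordColours = map (uncurry (colour c) ∘ chord) X

      spokeColour : ℕ → Fin 2 → ℕ
      spokeColour i τ = uncurry (colour c) (spoke i (s i) τ)

      -- The origin of the colour `n` of the step at position `p`: the steps at `2 i` and `2 i + 1`
      -- are the two spokes of round `i`.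
      data Kind (p n : ℕ) : Set where
        isSpoke : ∀ {i} τ → i < m → p ≡ toℕ τ + i * 2 → n ≡ spokeColour i τ → Kind p n
        isChord : p ≡ m * 2 → n ∈ chordColours → Kind p n

      Step : ℕ → Set
      Step p = Adj graph (v p) (v (suc p)) × Kind p (colour c (v p) (v (suc p)))

      step-odd : ∀ {i} → i < m → Step (suc (i * 2))
      step-odd {i} i<m =
        subst₂ (Adj graph) (sym (v-odd i)) (sym (v-even (suc i)))
          (spoke-adj i<m (pick< blob i<m) (Fin.suc Fin.zero)) ,
        isSpoke (Fin.suc Fin.zero) i<m refl (cong₂ (colour c) (v-odd i) (v-even (suc i)))

      step-even : ∀ {i} → i < m → Step (i * 2)
      step-even {i} i<m =
        subst₂ (Adj graph) (sym (v-even i)) (sym (v-odd i))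
          (Adj-sym graph (spoke-adj i<m (pick< blob i<m) Fin.zero)) ,
        isSpoke Fin.zero i<m refl
          (trans (cong₂ (colour c) (v-even i) (v-odd i)) (colour-sym c _ _))

      -- Here `m * 2 < k` forces `e` to be 1, and the chord closes the cycle.
      step-last : m * 2 < k → Step (m * 2)
      step-last m*2<k =
        subst₂ (Adj graph) (sym (v-even m)) (sym v-next) (chord-adj ends≢ ∈X) ,
        isChord refl (subst (_∈ chordColours) (sym (cong₂ (colour c) (v-even m) v-next))
          (∈-map⁺ (uncurry (colour c) ∘ chord) ∈X))
        where
        e≡1 : e ≡ 1
        e≡1 = ℕₚ.≤-antisym e≤1 (ℕₚ.+-cancelʳ-< (m * 2) 0 e (subst (m * 2 <_) k≡ m*2<k))
        k≡1+ : k ≡ suc (m * 2)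
        k≡1+ = trans k≡ (cong (_+ m * 2) e≡1)
        v-next : v (suc (m * 2)) ≡ at (row 0) 0
        v-next = trans (cong v (sym k≡1+)) v-wrap
        ends≢ : row (m * 2) ≢ row 0
        ends≢ eq = ℕₚ.<⇒≢ (ℕₚ.<-trans (s≤s z≤n) (s≤s⁻¹ (subst (3 ≤_) k≡1+ 3≤k)))
          (sym (trans (sym (toℕ-mod< m*2<k)) (trans (cong toℕ eq) (toℕ-mod< 0<k))))
        ∈X : (row (m * 2) , row 0) ∈ X
        ∈X = subst (λ n → (row (m * 2) , row 0) ∈ replicate n (row (m * 2) , row 0))
               (sym e≡1) (here refl)

      step : ∀ {p} → p < k → Step p
      step {p} p<k = at-parity (parity p) p<k
        where
        k≤ : k ≤ suc (m * 2)
        k≤ = subst (_≤ suc (m * 2)) (sym k≡) (ℕₚ.+-monoˡ-≤ (m * 2) e≤1)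
        at-parity : ∀ {p} → Parity p → p < k → Step p
        at-parity (odd i)  p<k = step-odd (ℕₚ.*-cancelʳ-< 2 i m (s<s⁻¹ (ℕₚ.≤-trans p<k k≤)))
        at-parity (even i) p<k = [ step-even , (λ { refl → step-last p<k }) ]′
          (ℕₚ.m≤n⇒m<n∨m≡n (ℕₚ.*-cancelʳ-≤ i m 2 (s≤s⁻¹ (ℕₚ.≤-trans p<k k≤))))

      -- The greedy choice makes the spoke colours distinct and different from that of the chord, so
      -- a colour determines its position.
      kind-injective : ∀ {p q n} → Kind p n → Kind q n → p ≡ q
      kind-injective (isSpoke σ i<m p≡ n≡) (isSpoke τ j<m q≡ n≡′) =
        let i≡j , σ≡τ = distinct blob i<m j<m (trans (sym n≡) n≡′)
        in trans p≡ (trans (cong₂ (λ σ i → toℕ σ + i * 2) σ≡τ i≡j) (sym q≡))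
      kind-injective (isSpoke σ i<m _ refl) (isChord _ n∈) = contradiction n∈ (fresh blob σ i<m)
      kind-injective (isChord _ n∈) (isSpoke τ i<m _ refl) = contradiction n∈ (fresh blob τ i<m)
      kind-injective (isChord p≡ _) (isChord q≡ _)         = trans p≡ (sym q≡)

      Next : Rel (Fin k) 0ℓ
      Next u w = toℕ w ≡ suc (toℕ u) ⊎ (suc (toℕ u) ≡ k × toℕ w ≡ 0)

      next-functional : ∀ {u w x} → Next u w → Next u x → w ≡ x
      next-functional (inj₁ w≡) (inj₁ x≡) = Finₚ.toℕ-injective (trans w≡ (sym x≡))
      next-functional {w = w} (inj₁ w≡) (inj₂ (u≡ , _)) =
        contradiction (trans w≡ u≡) (ℕₚ.<⇒≢ (Finₚ.toℕ<n w))
      next-functional {x = x} (inj₂ (u≡ , _)) (inj₁ x≡) =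
        contradiction (trans x≡ u≡) (ℕₚ.<⇒≢ (Finₚ.toℕ<n x))
      next-functional (inj₂ (_ , w≡)) (inj₂ (_ , x≡)) = Finₚ.toℕ-injective (trans w≡ (sym x≡))

      v-next : ∀ {u w} → Next u w → v (toℕ w) ≡ v (suc (toℕ u))
      v-next (inj₁ w≡)        = cong v w≡
      v-next (inj₂ (u≡ , w≡)) = trans (cong v w≡) (trans (sym v-wrap) (cong v (sym u≡)))

      v-injective : ∀ {u w : Fin k} → v (toℕ u) ≡ v (toℕ w) → u ≡ w
      v-injective {u} {w} eq = trans (sym (mod-toℕ u))
        (trans (at-row (atOdd s (toℕ u)) (atOdd s (toℕ w)) eq) (mod-toℕ w))

    rainbowCycle : ContainsRainbow (cycle k 3≤k) c
    rainbowCycle = rainbowCopy c Next id next-functional (v ∘ toℕ) v-injective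
      (λ {u} uw → subst (Adj graph (v (toℕ u))) (sym (v-next uw)) (proj₁ (step (Finₚ.toℕ<n u))))
      (λ {u} {w} {x} {y} uw xy eq → Finₚ.toℕ-injective (kind-injective
        (proj₂ (step (Finₚ.toℕ<n u)))
        (subst (Kind (toℕ x)) (sym (trans (cong (colour c (v (toℕ u))) (sym (v-next uw)))
          (trans eq (cong (colour c (v (toℕ x))) (v-next xy))))) (proj₂ (step (Finₚ.toℕ<n x))))))

-- From `m` to `suc m` the left side grows by `2 + 4 * (e + m * 2)`, the square by 2 more than that.
∑-cycle : ∀ e m → e ≤ 1 → e + 2 * ∑< m (slots 2 e) ≤ (e + m * 2) * (e + m * 2)
∑-cycle zero    zero    _         = z≤n
∑-cycle (suc _) zero    (s≤s z≤n) = ℕₚ.≤-refl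
∑-cycle e       (suc m) e≤1       = begin
  e + 2 * (slots 2 e m + S)                    ≡⟨ arith₁ e m S ⟩
  2 + 4 * (e + m * 2) + (e + 2 * S)            ≤⟨ ℕₚ.+-mono-≤ (ℕₚ.+-monoˡ-≤ (4 * (e + m * 2)) (ℕₚ.m≤m+n 2 2))
                                                    (∑-cycle e m e≤1) ⟩
  4 + 4 * (e + m * 2) + (e + m * 2) * (e + m * 2) ≡⟨ arith₂ e m ⟩
  (e + suc m * 2) * (e + suc m * 2)            ∎
  where
  open ℕₚ.≤-Reasoning
  S : ℕ
  S = ∑< m (slots 2 e)
  arith₁ : ∀ e m S → e + 2 * (suc (2 * (e + m * 2)) + S) ≡ 2 + 4 * (e + m * 2) + (e + 2 * S)
  arith₁ = solve-∀
  arith₂ : ∀ e m → 4 + 4 * (e + m * 2) + (e + m * 2) * (e + m * 2) ≡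
                   (e + suc m * 2) * (e + suc m * 2)
  arith₂ = solve-∀

cycle-forced : ∀ k (3≤k : 3 ≤ k) → ∃[ G ] (size G ≤ k ^ 2 × ForcesRainbow G (cycle k 3≤k))
cycle-forced k@(suc _) 3≤k = from (parity k) refl
  where
  -- `e` is the parity of `k`, and `m` counts the rows of candidates.
  build : ∀ e m → e ≤ 1 → k ≡ e + m * 2 → ∃[ G ] (size G ≤ k ^ 2 × ForcesRainbow G (cycle k 3≤k))
  build e m e≤1 k≡ = graph , ℕₚ.≤-trans size-graph (ℕₚ.≤-trans (∑-cycle e m e≤1)
      (ℕₚ.≤-reflexive (trans (cong (λ n → n * n) (sym k≡)) (cong (k *_) (sym (ℕₚ.*-identityʳ k))))))
    , rainbowCycle
    where open CycleGraph k 3≤k e m e≤1 k≡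
  from : ∀ {n} → Parity n → k ≡ n → ∃[ G ] (size G ≤ k ^ 2 × ForcesRainbow G (cycle k 3≤k))
  from (even m) k≡ = build 0 m z≤n k≡
  from (odd m)  k≡ = build 1 m ℕₚ.≤-refl k≡

-- From cycles to paths, and the conclusion

-- Restrict a rainbow cycle to its first `suc j` vertices.
cycle⇒path : ∀ {k j G} (3≤k : 3 ≤ k) → j < k → ForcesRainbow G (cycle k 3≤k) →
             ForcesRainbow G (path j)
cycle⇒path {k} {j} {G} 3≤k j<k forces c with forces c
... | φ , rb = rainbowCopy c (λ u v → toℕ v ≡ suc (toℕ u)) id
  (λ v≡ w≡ → Finₚ.toℕ-injective (trans v≡ (sym w≡)))
  (embed ∘ ι) (ι-injective ∘ injective) (λ uv → preserves (arc uv))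
  (λ {u} {v} {x} {y} uv xy eq → tails {u} {v} {x} {y} uv xy (rb (arc uv) (arc xy) eq))
  where
  open Copy φ
  ι : Fin (suc j) → Fin k
  ι u = inject≤ u j<k
  ι-injective : ∀ {u v} → ι u ≡ ι v → u ≡ v
  ι-injective {u} {v} = Finₚ.inject≤-injective j<k j<k u v
  arc : ∀ {u v} → toℕ v ≡ suc (toℕ u) → Adj (cycle k 3≤k) (ι u) (ι v)
  arc {u} {v} uv = fwd (inj₁ (trans (Finₚ.toℕ-inject≤ v j<k)
    (trans uv (cong suc (sym (Finₚ.toℕ-inject≤ u j<k))))))
  tails : ∀ {u v x y} → toℕ v ≡ suc (toℕ u) → toℕ y ≡ suc (toℕ x) →
          SameEdge (ι u , ι v) (ι x , ι y) → u ≡ x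
  tails _ _ (inj₁ (u≡x , _)) = ι-injective u≡x
  -- Reversed edges would give `x = v = u + 1 = y + 1 = x + 2`.
  tails {u} {v} {x} {y} uv xy (inj₂ (u≡y , v≡x)) = contradiction
    (trans (sym (cong toℕ (ι-injective v≡x))) (trans uv
      (cong suc (trans (cong toℕ (ι-injective u≡y)) xy))))
    (ℕₚ.m≢1+n+m (toℕ x) {1})

path-noIsolated : ∀ j → NoIsolated (path (suc j))
path-noIsolated j Fin.zero    = Fin.suc Fin.zero , fwd refl
path-noIsolated j (Fin.suc i) = inject₁ i , bwd (cong suc (sym (Finₚ.toℕ-inject₁ i)))

cycle-noIsolated : ∀ k (3≤k : 3 ≤ k) → NoIsolated (cycle k 3≤k)
cycle-noIsolated k@(suc _) 3≤k u with ℕₚ.m≤n⇒m<n∨m≡n (Finₚ.toℕ<n u)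
... | inj₁ 1+u<k = fromℕ< 1+u<k , fwd (inj₁ (Finₚ.toℕ-fromℕ< 1+u<k))
... | inj₂ 1+u≡k = Fin.zero , fwd (inj₂ (1+u≡k , refl))

-- This is `union-lower-bound` for two matchings, rewritten with fractions.
path-bound : ∀ {j p} → IsARₛ (path j) p → (+ (suc j * j)) / 4 ≤ℚ (+ p) / 1
path-bound {j} {p} AR = bound (IsARₛ.attained AR)
  where
  bound : ∃[ G ] (size G ≡ p × ForcesRainbow G (path j)) → (+ (suc j * j)) / 4 ≤ℚ (+ p) / 1
  bound (G , |G|≡p , forces) = *≤* (subst₂ ℤ._≤_ (ℤₚ.pos-* (suc j * j) 1) (ℤₚ.pos-* p 4)
    (ℤ.+≤+ (begin
      suc j * j * 1     ≡⟨ ℕₚ.*-identityʳ (suc j * j) ⟩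
      suc j * j         ≡⟨ ℕₚ.*-comm (suc j) j ⟩
      j * suc j         ≤⟨ union-lower-bound 2 j G (path-union G j forces) ⟩
      4 * size G        ≡⟨ ℕₚ.*-comm 4 (size G) ⟩
      size G * 4        ≡⟨ cong (_* 4) |G|≡p ⟩
      p * 4             ∎)))
    where open ℕₚ.≤-Reasoning

-- Existence of the minimum needs some forcing graph; one that forces a long enough cycle serves and
-- bounds the value.
AR-path : ∀ {k j G} (3≤k : 3 ≤ k) → suc j < k → ForcesRainbow G (cycle k 3≤k) →
          ∃[ p ] (IsARₛ (path (suc j)) p × p ≤ size G)
AR-path {j = j} {G} 3≤k j<k forces = existsAR (path-noIsolated j) G (cycle⇒path 3≤k j<k forces)

AR-cycle : ∀ k (3≤k : 3 ≤ k) → ∃[ c ] (IsARₛ (cycle k 3≤k) c × c ≤ k ^ 2)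
AR-cycle k 3≤k =
  let G , G≤k² , forces = cycle-forced k 3≤k
      c , AR , c≤G      = existsAR (cycle-noIsolated k 3≤k) G forces
  in c , AR , ℕₚ.≤-trans c≤G G≤k²

theorem6 : ((k : ℕ) → 2 ≤ k →
    (∃[ p ] (IsARₛ (path (k ∸ 1)) p × (+ (k * (k ∸ 1))) / 4 ≤ℚ (+ p) / 1))
    × IsARₛ (matching k) (suc k C 2))
    × ((k : ℕ) (3≤k : 3 ≤ k) →
    ∃[ p ] ∃[ c ] (IsARₛ (path (k ∸ 1)) p × IsARₛ (cycle k 3≤k) c × p ≤ c × c ≤ k ^ 2))
theorem6 = pathsAndMatchings , pathsAndCycles
  where
  pathsAndMatchings : (k : ℕ) → 2 ≤ k →
    (∃[ p ] (IsARₛ (path (k ∸ 1)) p × (+ (k * (k ∸ 1))) / 4 ≤ℚ (+ p) / 1))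
    × IsARₛ (matching k) (suc k C 2)
  pathsAndMatchings (suc zero)      (s≤s ())
  pathsAndMatchings k@(suc (suc _)) 2≤k        =
    -- A cycle of length `suc k`, because `k` may be 2.
    let G , _ , forces = cycle-forced (suc k) (s≤s 2≤k)
        p , AR , _     = AR-path (s≤s 2≤k) (ℕₚ.n≤1+n k) forces
    in (p , AR , path-bound AR) , AR-matching k

  pathsAndCycles : (k : ℕ) (3≤k : 3 ≤ k) →
    ∃[ p ] ∃[ c ] (IsARₛ (path (k ∸ 1)) p × IsARₛ (cycle k 3≤k) c × p ≤ c × c ≤ k ^ 2)
  pathsAndCycles (suc zero)      (s≤s ())
  pathsAndCycles k@(suc (suc _)) 3≤k        =
    let c , ARc , c≤k²       = AR-cycle k 3≤k
        -- An optimal graph for the cycle also forces the path, whence `p ≤ c`.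
        K , |K|≡c , forces   = IsARₛ.attained ARc
        p , ARp , p≤|K|      = AR-path 3≤k ℕₚ.≤-refl forces
    in p , c , ARp , ARc , subst (p ≤_) |K|≡c p≤|K| , c≤k²
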